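{- An epr-sequence starting with $\mathtt{N}$ is attainable by a symmetric matrix over $\mathbb{Z}_2$ if and only if it has one of the following forms: 1. $\mathtt{NA}\overline{\mathtt{NA}}$; 2. $\mathtt{NA}\overline{\mathtt{NA}}\mathtt{N}$; 3. $\overline{\mathtt{NS}}\mathtt{N}\overline{\mathtt{N}}$; 4. $\mathtt{NS}\overline{\mathtt{NS}}\mathtt{NA}$; 5. $\mathtt{NS}\overline{\mathtt{NS}}\mathtt{NAN}$.
   Context: $\mathbb{Z}_2$ is the field of integers modulo $2$. For an $n\times n$ symmetric matrix $B$ over a field $\mathbb{F}$, the enhanced principal rank characteristic sequence (epr-sequence) is $\operatorname{epr}(B)=\ell_1\ell_2\cdots\ell_n$, where $\ell_k=\mathtt{A}$ if all principal minors of $B$ of order $k$ are nonzero, $\ell_k=\mathtt{S}$ if some but not all principal minors of order $k$ are nonzero, and $\ell_k=\mathtt{N}$ if all principal minors of order $k$ are zero. A finite nonempty sequence over $\{\mathtt{A},\mathtt{S},\mathtt{N}\}$ is attainable over $\mathbb{F}$ if it equals $\operatorname{epr}(B)$ for some symmetric matrix $B$ over $\mathbb{F}$; its order is its length. In a form, an overlined block $\overline{t_1\cdots t_k}$ stands for the block $t_1\cdots t_k$ repeated any number of times $\geq 0$ (so it may be omitted entirely); a sequence "has a form" if it is obtained by some choice of the repetition numbers, chosen independently for each overlined block. -}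

module Defs where

open import Algebra.Bundles using (CommutativeRing)
import Algebra.Properties.Monoid.Sum as Sum
import Algebra.Properties.Semiring.Exp as Exp
open import Data.Fin.Base using (Fin; zero; suc; toℕ)
open import Data.Fin.Subset using (Subset; inside; outside; ∣_∣)
open import Data.List.Base using (List; []; _∷_; length; lookup; concat; replicate)
open import Data.Nat.Base using (ℕ; zero; suc)
open import Data.Parity.Properties using (+-*-commutativeRing)
open import Data.Product.Base using (_×_; ∃-syntax; Σ-syntax)
open import Data.Vec.Base using (_∷_)
open import Data.Vec.Functional using (Vector; removeAt)
open import Level using (0ℓ; _⊔_)
open import Relation.Binary.PropositionalEquality.Core using (_≡_; _≢_)
open import Relation.Nullary.Negation.Core using (¬_)

data Letter : Set where
  A S N : Letter

-- The increasing enumeration of the elements of a subset.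
enumerate : ∀ {n} (α : Subset n) → Fin ∣ α ∣ → Fin n
enumerate (outside ∷ α) i       = suc (enumerate α i)
enumerate (inside  ∷ α) zero    = zero
enumerate (inside  ∷ α) (suc i) = suc (enumerate α i)

module _ {c ℓ} (R : CommutativeRing c ℓ) where
  open CommutativeRing R
    using (_≈_; _*_; -_; 0#; 1#; +-monoid; semiring)
    renaming (Carrier to F)
  open Sum +-monoid using (sum)
  open Exp semiring using (_^_)

  SquareMatrix : ℕ → Set c
  SquareMatrix n = Vector (Vector F n) n

  Symmetric : ∀ {n} → SquareMatrix n → Set ℓ
  Symmetric B = ∀ i j → B i j ≈ B j i

  -- Laplace expansion along the first row; the determinant of the 0 × 0
  -- matrix is 1.
  det : ∀ {n} → SquareMatrix n → F
  det {zero}  B = 1#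
  det {suc n} B = sum λ j →
    (- 1#) ^ toℕ j * B zero j * det (λ i → removeAt (B (suc i)) j)

  principalSubmatrix : ∀ {n} → SquareMatrix n → (α : Subset n) → SquareMatrix ∣ α ∣
  principalSubmatrix B α i j = B (enumerate α i) (enumerate α j)

  principalMinor : ∀ {n} → SquareMatrix n → Subset n → F
  principalMinor B α = det (principalSubmatrix B α)

  AllNonzero SomeNonzero AllZero : ∀ {n} → SquareMatrix n → ℕ → Set ℓ
  AllNonzero  B k = ∀ α → ∣ α ∣ ≡ k → ¬ (principalMinor B α ≈ 0#)
  SomeNonzero B k = ∃[ α ] (∣ α ∣ ≡ k × ¬ (principalMinor B α ≈ 0#))
  AllZero     B k = ∀ α → ∣ α ∣ ≡ k → principalMinor B α ≈ 0#

  -- IsTerm B k x: the k-th term of epr(B) is x.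
  IsTerm : ∀ {n} → SquareMatrix n → ℕ → Letter → Set ℓ
  IsTerm B k A = AllNonzero B k
  IsTerm B k S = SomeNonzero B k × ¬ AllNonzero B k
  IsTerm B k N = AllZero B k

  -- IsEpr s B: epr(B) = s.  The order of B is forced to be the length of s,
  -- and the position i, counted from 0, holds the term of index i + 1.
  IsEpr : (s : List Letter) → SquareMatrix (length s) → Set ℓ
  IsEpr s B = ∀ i → IsTerm B (suc (toℕ i)) (lookup s i)

  Attainable : List Letter → Set (c ⊔ ℓ)
  Attainable s =
    s ≢ [] × Σ[ B ∈ SquareMatrix (length s) ] (Symmetric B × IsEpr s B)

-- The integers modulo 2, as the ring of parities (where - x = x).
ℤ₂ : CommutativeRing 0ℓ 0ℓ
ℤ₂ = +-*-commutativeRing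

NA NS : List Letter
NA = N ∷ A ∷ []
NS = N ∷ S ∷ []

-- The block t repeated m times.
infixr 8 _^_

_^_ : List Letter → ℕ → List Letter
t ^ m = concat (replicate m t)

{-# OPTIONS --safe #-}
-- A symmetric matrix B over ℤ₂ whose sequence begins with N has zero diagonal, so it is
-- an alternating form, that is, the adjacency matrix of a graph.  Its principal minor on
-- α is nonzero exactly when no nonzero vector v supported on α has B v = 0 on α.
--
-- If the minor on α is nonzero, solve B v = eᵢ on α for some i in α; then vᵢ = vᵀ B v = 0,
-- and removing i and any j with vⱼ = 1 leaves a nonzero minor.  Hence the minors of odd
-- order vanish, and an N in an even position is followed by N only.
--
-- If all minors of order 2k ≥ 2 are nonzero, the kernel of each principal submatrix of
-- order 2k + 1 is spanned by the all-ones vector.  Comparing two such submatrices inside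
-- one of order 2k + 2 shows that all off-diagonal entries of B agree, so that the graph
-- is complete and every even position holds A.  So after NS an A can only occur in the
-- last even position.
--
-- The forms are realized by complete graphs, by disjoint edges with isolated vertices,
-- and, for NS⋯NSNAN, by the friendship graphs (triangles sharing one vertex).
module Submission where

open import Defs
open import Data.List.Base using (List; [_]; _++_; head)
open import Data.Maybe.Base using (just)
open import Data.Product.Base using (∃-syntax)
open import Data.Sum.Base using (_⊎_)
open import Function.Bundles using (_⇔_)
open import Relation.Binary.PropositionalEquality.Core using (_≡_)

open import Algebra.Bundles using (CommutativeRing)
import Algebra.Properties.Semiring.Exp (CommutativeRing.semiring ℤ₂) as Exp
open import Algebra.Properties.Semiring.Sum (CommutativeRing.semiring ℤ₂)
  using (sum; sum-cong-≗; sum-remove; sum-replicate-zero; ∑-distrib-+; ∑-comm; *-distribˡ-sum; *-distribʳ-sum)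
import Algebra.Solver.Ring.Simple as RingSolver
open import Algebra.Solver.Ring.AlmostCommutativeRing using (fromCommutativeRing)
open import Data.Fin.Base using (Fin; zero; suc; toℕ; punchIn; punchOut)
open import Data.Fin.Properties as Fin using (any?; punchIn-punchOut; punchInᵢ≢i)
open import Data.Fin.Subset
  using (Subset; inside; outside; ∣_∣; _∈_; _∉_; _⊆_; _∪_; _-_; ⁅_⁆; ⊤; ⊥)
open import Data.Fin.Subset.Properties
  using ( _∈?_; ∈⊤; ∉⊥; ⊆⊤; ∪-identityʳ; p⊆p∪q; q⊆p∪q; p─⊥≡p; p─q⊆p
        ; x∈⁅x⁆; x∈⁅y⁆⇒x≡y; x∈p∧x≢y⇒x∈p-y
        ; ∣⊥∣≡0; ∣⊤∣≡n; ∣⁅x⁆∣≡1; ∣p∣≡n⇒p≡⊤; p⊆q⇒∣p∣≤∣q∣ )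
open import Data.List.Base using ([]; _∷_; length; lookup)
open import Data.List.Properties using (++-identityʳ)
open import Data.Nat.Base as ℕ using (ℕ; zero; suc; _≤_; _<_; z≤n; s≤s; _≤′_; ≤′-reflexive; ≤′-step)
open import Data.Nat.Properties as ℕ
  using (≤-trans; ≤-refl; ≤-reflexive; ≤⇒≤′; <⇒≱; m≤n⇒m<n∨m≡n; m≤n⇒m≤1+n; m≤n+m; suc-injective; +-suc)
open import Data.Parity.Base using (Parity; 0ℙ; 1ℙ; _*_) renaming (_+_ to infixl 6 _+_)
open import Data.Parity.Properties as ℙ using (p+p≡0ℙ)
open import Data.Product.Base using (_×_; _,_; proj₁; proj₂)
open import Data.Sum.Base using (inj₁; inj₂)
open import Data.Unit.Base using (tt) renaming (⊤ to Unit)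
open import Data.Vec.Base using (_∷_; []; here; there)
open import Data.Vec.Functional using (Vector; removeAt) renaming (_∷_ to infixr 5 _∷ᶠ_)
open import Function.Base using (_∘_; case_of_)
open import Function.Bundles using (mk⇔)
open import Relation.Binary.PropositionalEquality
  using (_≢_; refl; sym; trans; cong; cong₂; subst; module ≡-Reasoning)
open import Relation.Nullary using (¬_; Dec; yes; no; contradiction)

open RingSolver (fromCommutativeRing ℤ₂) ℙ._≟_ using (solve; con; _:+_; _:*_; _:=_)
open ≡-Reasoning

-- Sums, dot products and unit vectors over ℤ₂.

sum-zero : ∀ {n} {f : Vector Parity n} → (∀ i → f i ≡ 0ℙ) → sum f ≡ 0ℙ
sum-zero {n} f≡0 = trans (sum-cong-≗ {n} f≡0) (sum-replicate-zero n)

sum-single : ∀ {n} (f : Vector Parity n) i → (∀ j → j ≢ i → f j ≡ 0ℙ) → sum f ≡ f i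
sum-single {suc n} f i f≡0 = begin
  sum f                        ≡⟨ sum-remove {i = i} f ⟩
  f i + sum (removeAt f i)     ≡⟨ cong (f i +_) (sum-zero λ j → f≡0 _ (punchInᵢ≢i i j)) ⟩
  f i + 0ℙ                     ≡⟨ ℙ.+-identityʳ (f i) ⟩
  f i                          ∎

p+q≡0⇒p≡q : ∀ p q → p + q ≡ 0ℙ → p ≡ q
p+q≡0⇒p≡q 0ℙ 0ℙ _ = refl
p+q≡0⇒p≡q 1ℙ 1ℙ _ = refl

≢0⇒≡1 : ∀ {p} → p ≢ 0ℙ → p ≡ 1ℙ
≢0⇒≡1 {0ℙ} p≢0 = contradiction refl p≢0
≢0⇒≡1 {1ℙ} _   = refl

≢1⇒≡0 : ∀ {p} → p ≢ 1ℙ → p ≡ 0ℙ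
≢1⇒≡0 {0ℙ} _   = refl
≢1⇒≡0 {1ℙ} p≢1 = contradiction refl p≢1

1≢0 : 1ℙ ≢ 0ℙ
1≢0 ()

infix 8 _·_

_·_ : ∀ {n} → Vector Parity n → Vector Parity n → Parity
u · v = sum λ i → u i * v i

·-cong : ∀ {n} {u u′ v v′ : Vector Parity n} →
         (∀ i → u i ≡ u′ i) → (∀ i → v i ≡ v′ i) → u · v ≡ u′ · v′
·-cong u≗u′ v≗v′ = sum-cong-≗ λ i → cong₂ _*_ (u≗u′ i) (v≗v′ i)

·-comm : ∀ {n} (u v : Vector Parity n) → u · v ≡ v · u
·-comm u v = sum-cong-≗ λ i → ℙ.*-comm (u i) (v i)

_+[_]_ : ∀ {n} → Vector Parity n → Parity → Vector Parity n → Vector Parity n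
(u +[ c ] v) i = u i + c * v i

·-linearˡ : ∀ {n} (u : Vector Parity n) c v w → (u +[ c ] v) · w ≡ u · w + c * (v · w)
·-linearˡ u c v w = begin
  (sum λ i → (u i + c * v i) * w i)
    ≡⟨ sum-cong-≗ (λ i → solve 4 (λ u c v w → (u :+ c :* v) :* w := u :* w :+ c :* (v :* w)) refl (u i) c (v i) (w i)) ⟩
  (sum λ i → u i * w i + c * (v i * w i))
    ≡⟨ ∑-distrib-+ (λ i → u i * w i) (λ i → c * (v i * w i)) ⟩
  u · w + (sum λ i → c * (v i * w i))
    ≡⟨ cong (u · w +_) (*-distribˡ-sum c (λ i → v i * w i)) ⟨
  u · w + c * (v · w) ∎

·-linearʳ : ∀ {n} (u : Vector Parity n) c v w → w · (u +[ c ] v) ≡ w · u + c * (w · v)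
·-linearʳ u c v w = begin
  w · (u +[ c ] v)     ≡⟨ ·-comm w (u +[ c ] v) ⟩
  (u +[ c ] v) · w     ≡⟨ ·-linearˡ u c v w ⟩
  u · w + c * (v · w)  ≡⟨ cong₂ (λ x y → x + c * y) (·-comm u w) (·-comm v w) ⟩
  w · u + c * (w · v)  ∎

·-zeroˡ : ∀ {n} {u : Vector Parity n} v → (∀ i → u i ≡ 0ℙ) → u · v ≡ 0ℙ
·-zeroˡ v u≡0 = sum-zero λ i → cong (_* v i) (u≡0 i)

·-zeroʳ : ∀ {n} u {v : Vector Parity n} → (∀ i → v i ≡ 0ℙ) → u · v ≡ 0ℙ
·-zeroʳ u {v} v≡0 = trans (·-comm u v) (·-zeroˡ u v≡0)

combination : ∀ {m n} → Vector Parity m → Vector (Vector Parity n) m → Vector Parity n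
combination c M j = c · λ i → M i j

combination-assoc : ∀ {m n} (c : Vector Parity m) (M : Vector (Vector Parity n) m) v →
  combination c M · v ≡ c · λ i → M i · v
combination-assoc c M v = begin
  (sum λ j → (sum λ i → c i * M i j) * v j)
    ≡⟨ sum-cong-≗ (λ j → *-distribʳ-sum (v j) (λ i → c i * M i j)) ⟩
  (sum λ j → sum λ i → c i * M i j * v j)
    ≡⟨ ∑-comm (λ j i → c i * M i j * v j) ⟩
  (sum λ i → sum λ j → c i * M i j * v j)
    ≡⟨ sum-cong-≗ (λ i → sum-cong-≗ λ j → ℙ.*-assoc (c i) (M i j) (v j)) ⟩
  (sum λ i → sum λ j → c i * (M i j * v j))
    ≡⟨ sum-cong-≗ (λ i → *-distribˡ-sum (c i) (λ j → M i j * v j)) ⟨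
  (sum λ i → c i * (M i · v)) ∎

unit : ∀ {n} → Fin n → Vector Parity n
unit zero    zero    = 1ℙ
unit zero    (suc j) = 0ℙ
unit (suc i) zero    = 0ℙ
unit (suc i) (suc j) = unit i j

unit-diag : ∀ {n} (i : Fin n) → unit i i ≡ 1ℙ
unit-diag zero    = refl
unit-diag (suc i) = unit-diag i

unit-off : ∀ {n} {i j : Fin n} → j ≢ i → unit i j ≡ 0ℙ
unit-off {i = zero}  {zero}  j≢i = contradiction refl j≢i
unit-off {i = zero}  {suc j} j≢i = refl
unit-off {i = suc i} {zero}  j≢i = refl
unit-off {i = suc i} {suc j} j≢i = unit-off {i = i} (j≢i ∘ cong suc)

unit-· : ∀ {n} (i : Fin n) v → unit i · v ≡ v i
unit-· i v = trans
  (sum-single (λ j → unit i j * v j) i λ j j≢i → cong (_* v j) (unit-off j≢i))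
  (cong (_* v i) (unit-diag i))

-- Determinants

removeColumn : ∀ {m n} → Vector (Vector Parity (suc n)) m → Fin (suc n) → Vector (Vector Parity n) m
removeColumn M j i = removeAt (M i) j

-- Maximal minors of a matrix with one row too few. Over ℤ₂ no signs occur, so pairing a row with
-- them gives the determinant of `M` with that row on top.
cofactors : ∀ {n} → Vector (Vector Parity (suc n)) n → Vector Parity (suc n)
cofactors M j = det ℤ₂ (removeColumn M j)

1^n≡1 : ∀ n → 1ℙ Exp.^ n ≡ 1ℙ
1^n≡1 zero    = refl
1^n≡1 (suc n) = 1^n≡1 n

det-expand : ∀ {n} (B : SquareMatrix ℤ₂ (suc n)) → det ℤ₂ B ≡ B zero · cofactors (B ∘ suc)
det-expand B = sum-cong-≗ λ j →
  cong (λ x → x * B zero j * cofactors (B ∘ suc) j) (1^n≡1 (toℕ j))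

det-cong : ∀ {n} {B C : SquareMatrix ℤ₂ n} → (∀ i j → B i j ≡ C i j) → det ℤ₂ B ≡ det ℤ₂ C
det-cong {zero}          B≗C = refl
det-cong {suc n} {B} {C} B≗C = begin
  det ℤ₂ B                       ≡⟨ det-expand B ⟩
  B zero · cofactors (B ∘ suc)   ≡⟨ ·-cong (B≗C zero) (λ j → det-cong λ i k → B≗C (suc i) (punchIn j k)) ⟩
  C zero · cofactors (C ∘ suc)   ≡⟨ det-expand C ⟨
  det ℤ₂ C                       ∎

det-zeroColumn : ∀ {n} (B : SquareMatrix ℤ₂ n) q → (∀ i → B i q ≡ 0ℙ) → det ℤ₂ B ≡ 0ℙ
det-zeroColumn {suc n} B q B≡0 = trans (det-expand B) (sum-zero term)
  where
  term : ∀ j → B zero j * cofactors (B ∘ suc) j ≡ 0ℙ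
  term j with j Fin.≟ q
  ... | yes refl = cong (_* cofactors (B ∘ suc) j) (B≡0 zero)
  ... | no  j≢q  = trans (cong (B zero j *_) (det-zeroColumn (removeColumn (B ∘ suc) j) (punchOut j≢q) λ i →
    trans (cong (B (suc i)) (punchIn-punchOut j≢q)) (B≡0 (suc i)))) (ℙ.*-zeroʳ (B zero j))

-- det (r ∷ s ∷ M)
det₂ : ∀ {n} (r s : Vector Parity (suc (suc n))) → Vector (Vector Parity (suc (suc n))) n → Parity
det₂ r s M = r · λ j → removeAt s j · cofactors (removeColumn M j)

det₂-cofactors : ∀ {n} r (M : Vector (Vector Parity (suc (suc n))) (suc n)) →
  r · cofactors M ≡ det₂ r (M zero) (M ∘ suc)
det₂-cofactors r M = ·-cong {u = r} (λ _ → refl) λ j → det-expand (removeColumn M j)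

-- The terms of the expansion of a determinant along two equal rows s cancel in
-- pairs, whatever function g of the remaining columns stands for the minors.
paired-columns-cancel : ∀ {A : Set} n (s : A → Parity) (g : Vector A n → Parity) →
  (∀ {X Y} → (∀ i → X i ≡ Y i) → g X ≡ g Y) → (X : Vector A (suc (suc n))) →
  (sum λ j → sum λ k → s (X j) * (s (removeAt X j k) * g (removeAt (removeAt X j) k))) ≡ 0ℙ
paired-columns-cancel n s g g-cong X = begin
  h zero + sum (h ∘ suc)   ≡⟨ cong (h zero +_) (∑-distrib-+ p q) ⟩
  h zero + (sum p + sum q) ≡⟨ cong₂ (λ x y → h zero + (x + y)) (sum-cong-≗ p≗h₀) (tails n X g g-cong) ⟩
  h zero + (h zero + 0ℙ)   ≡⟨ solve 1 (λ x → x :+ (x :+ con 0ℙ) := con 0ℙ) refl (h zero) ⟩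
  0ℙ                       ∎
  where
  term : ∀ j k → Parity
  term j k = s (X j) * (s (removeAt X j k) * g (removeAt (removeAt X j) k))
  h : Vector Parity (suc (suc n))
  h j = sum (term j)
  p q : Vector Parity (suc n)
  p j = term (suc j) zero
  q j = sum λ k → term (suc j) (suc k)
  -- Removing columns 0 and j + 1 in either order leaves the same columns, so these terms repeat
  -- those of `h zero`.
  p≗h₀ : ∀ j → p j ≡ term zero j
  p≗h₀ j = trans (solve 3 (λ a b c → a :* (b :* c) := b :* (a :* c)) refl (s (X (suc j))) (s (X zero)) _)
    (cong (λ x → s (X zero) * (s (X (suc j)) * x)) (g-cong λ k → refl))
  -- Column 0 survives in every remaining term, so it is absorbed into `g` and the induction runs on
  -- one column fewer.
  tails : ∀ n (X : Vector _ (suc (suc n))) (g : Vector _ n → Parity) →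
    (∀ {X Y} → (∀ i → X i ≡ Y i) → g X ≡ g Y) →
    (sum λ j → sum λ k → s (X (suc j)) * (s (removeAt X (suc j) (suc k)) * g (removeAt (removeAt X (suc j)) (suc k)))) ≡ 0ℙ
  tails zero    X g g-cong = refl
  tails (suc n) X g g-cong = trans
    (sum-cong-≗ λ j → sum-cong-≗ λ k → cong (λ x → s (X (suc j)) * (s (removeAt X (suc j) (suc k)) * x))
      (g-cong {removeAt (removeAt X (suc j)) (suc k)} {X zero ∷ᶠ removeAt (removeAt (X ∘ suc) j) k} λ { zero → refl ; (suc i) → refl }))
    (paired-columns-cancel n s (λ Y → g (X zero ∷ᶠ Y))
      (λ Y≗Z → g-cong λ { zero → refl ; (suc i) → Y≗Z i }) (X ∘ suc))

det₂-alternating : ∀ {n} s (M : Vector (Vector Parity (suc (suc n))) n) → det₂ s s M ≡ 0ℙ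
det₂-alternating {n} s M = trans
  (sum-cong-≗ λ j → *-distribˡ-sum (s j) (λ k → removeAt s j k * cofactors (removeColumn M j) k))
  (paired-columns-cancel n s (λ X → det ℤ₂ (λ i k → M i (X k)))
    (λ X≗Y → det-cong λ i k → cong (M i) (X≗Y k)) (λ j → j))

det₂-linearˡ : ∀ {n} r c t s (M : Vector (Vector Parity (suc (suc n))) n) →
  det₂ (r +[ c ] t) s M ≡ det₂ r s M + c * det₂ t s M
det₂-linearˡ r c t s M = ·-linearˡ r c t λ j → removeAt s j · cofactors (removeColumn M j)

det₂-linearʳ : ∀ {n} r c t s (M : Vector (Vector Parity (suc (suc n))) n) →
  det₂ s (r +[ c ] t) M ≡ det₂ s r M + c * det₂ s t M
det₂-linearʳ r c t s M = trans
  (·-cong {u = s} (λ _ → refl) λ j → ·-linearˡ (removeAt r j) c (removeAt t j) (cofactors (removeColumn M j)))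
  (·-linearʳ (λ j → removeAt r j · cofactors (removeColumn M j)) c (λ j → removeAt t j · cofactors (removeColumn M j)) s)

-- Polarization: when the form is expanded at `r` + `s` in both arguments, the diagonal terms vanish
-- and the two mixed ones add up to zero, hence agree in characteristic 2.
det₂-swap : ∀ {n} r s (M : Vector (Vector Parity (suc (suc n))) n) → det₂ r s M ≡ det₂ s r M
det₂-swap r s M = p+q≡0⇒p≡q _ _ (begin
  det₂ r s M + det₂ s r M
    ≡⟨ cong₂ _+_ (cong (_+ det₂ r s M) (det₂-alternating r M))
         (trans (cong (det₂ s r M +_) (det₂-alternating s M)) (ℙ.+-identityʳ _)) ⟨
  (det₂ r r M + det₂ r s M) + (det₂ s r M + det₂ s s M)
    ≡⟨ cong₂ _+_ (det₂-linearʳ r 1ℙ s r M) (det₂-linearʳ r 1ℙ s s M) ⟨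
  det₂ r (r +[ 1ℙ ] s) M + det₂ s (r +[ 1ℙ ] s) M
    ≡⟨ det₂-linearˡ r 1ℙ s (r +[ 1ℙ ] s) M ⟨
  det₂ (r +[ 1ℙ ] s) (r +[ 1ℙ ] s) M
    ≡⟨ det₂-alternating (r +[ 1ℙ ] s) M ⟩
  0ℙ ∎)

-- The multiple of `r` added to the second row drops out because the form is alternating. Swapping
-- the first two rows puts `r` on top of each smaller minor, where induction applies.
det-addFirstRow : ∀ {n} (r : Vector Parity (suc n)) (M : Vector (Vector Parity (suc n)) n) (c : Vector Parity n) →
  r · cofactors (λ i → M i +[ c i ] r) ≡ r · cofactors M
det-addFirstRow {zero}  r M c = refl
det-addFirstRow {suc n} r M c = begin
  r · cofactors M⁺              ≡⟨ det₂-cofactors r M⁺ ⟩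
  det₂ r (s +[ c zero ] r) M″   ≡⟨ det₂-linearʳ s (c zero) r r M″ ⟩
  det₂ r s M″ + c zero * det₂ r r M″
    ≡⟨ cong (λ x → det₂ r s M″ + c zero * x) (det₂-alternating r M″) ⟩
  det₂ r s M″ + c zero * 0ℙ     ≡⟨ solve 2 (λ x c → x :+ c :* con 0ℙ := x) refl _ (c zero) ⟩
  det₂ r s M″                   ≡⟨ det₂-swap r s M″ ⟩
  det₂ s r M″
    ≡⟨ ·-cong {u = s} (λ _ → refl) (λ j → det-addFirstRow (removeAt r j) (removeColumn (M ∘ suc) j) (c ∘ suc)) ⟩
  det₂ s r (M ∘ suc)            ≡⟨ det₂-swap s r (M ∘ suc) ⟩
  det₂ r s (M ∘ suc)            ≡⟨ det₂-cofactors r M ⟨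
  r · cofactors M               ∎
  where
  s = M zero
  M⁺ = λ i → M i +[ c i ] r
  M″ = M⁺ ∘ suc

-- This is the determinant of `M` with a combination of its own rows on top. The share of the first
-- row of `M` drops out; the rest is swapped below that row, so that induction applies to the
-- minors.
·-cofactors-combination : ∀ {n} c (M : Vector (Vector Parity (suc n)) n) →
  combination c M · cofactors M ≡ 0ℙ
·-cofactors-combination {zero}  c M = refl
·-cofactors-combination {suc n} c M = begin
  combination c M · cofactors M
    ≡⟨ ·-cong {v = cofactors M} (λ j → ℙ.+-comm (c zero * s j) (t j)) (λ _ → refl) ⟩
  (t +[ c zero ] s) · cofactors M        ≡⟨ det₂-cofactors (t +[ c zero ] s) M ⟩
  det₂ (t +[ c zero ] s) s M′            ≡⟨ det₂-linearˡ t (c zero) s s M′ ⟩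
  det₂ t s M′ + c zero * det₂ s s M′     ≡⟨ cong (λ x → det₂ t s M′ + c zero * x) (det₂-alternating s M′) ⟩
  det₂ t s M′ + c zero * 0ℙ              ≡⟨ solve 2 (λ x c → x :+ c :* con 0ℙ := x) refl _ (c zero) ⟩
  det₂ t s M′                            ≡⟨ det₂-swap t s M′ ⟩
  det₂ s t M′                            ≡⟨ ·-zeroʳ s (λ j → ·-cofactors-combination (c ∘ suc) (removeColumn M′ j)) ⟩
  0ℙ                                     ∎
  where
  s = M zero
  M′ = M ∘ suc
  t = combination (c ∘ suc) M′

·-cofactors-row : ∀ {n} (M : Vector (Vector Parity (suc n)) n) i → M i · cofactors M ≡ 0ℙ
·-cofactors-row M i = trans
  (·-cong {v = cofactors M} (λ j → sym (unit-· i (λ k → M k j))) (λ _ → refl))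
  (·-cofactors-combination (unit i) M)

Dependent : ∀ {m n} → Vector (Vector Parity n) m → Set
Dependent M = ∃[ c ] ((∃[ i ] c i ≡ 1ℙ) × ∀ j → combination c M j ≡ 0ℙ)

-- If the first coefficient is 1, the first row is a combination of the others; if it is 0, the
-- other rows stay dependent in every minor of the expansion.
dependent⇒det≡0 : ∀ {n} (B : SquareMatrix ℤ₂ n) → Dependent B → det ℤ₂ B ≡ 0ℙ
dependent⇒det≡0 {suc n} B (c , (i , cᵢ≡1) , cB≡0) with c zero in c₀≡
... | 1ℙ = begin
  det ℤ₂ B                      ≡⟨ det-expand B ⟩
  B zero · cofactors (B ∘ suc)  ≡⟨ ·-cong {v = cofactors (B ∘ suc)}
                                    (λ j → p+q≡0⇒p≡q (B zero j) (combination (c ∘ suc) (B ∘ suc) j) (cB≡0 j))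
                                    (λ _ → refl) ⟩
  combination (c ∘ suc) (B ∘ suc) · cofactors (B ∘ suc) ≡⟨ ·-cofactors-combination (c ∘ suc) (B ∘ suc) ⟩
  0ℙ                            ∎
... | 0ℙ = trans (det-expand B) (·-zeroʳ (B zero) λ j →
  dependent⇒det≡0 (removeColumn (B ∘ suc) j) (c ∘ suc , nonzero i cᵢ≡1 , λ k → cB≡0 (punchIn j k)))
  where
  nonzero : ∀ i → c i ≡ 1ℙ → ∃[ i′ ] c (suc i′) ≡ 1ℙ
  nonzero zero    c₀≡1 = contradiction (trans (sym c₀≡1) c₀≡) 1≢0
  nonzero (suc i) cᵢ≡1 = i , cᵢ≡1

-- A step of Gaussian elimination: the first row is added to every row with a 1 in column `q`, which
-- clears that column when the pivot is 1.
eliminate : ∀ {n} → SquareMatrix ℤ₂ (suc n) → Fin (suc n) → Vector (Vector Parity (suc n)) n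
eliminate B q i = B (suc i) +[ B (suc i) q ] B zero

eliminate-pivot : ∀ {n} (B : SquareMatrix ℤ₂ (suc n)) {q} → B zero q ≡ 1ℙ →
  ∀ i → eliminate B q i q ≡ 0ℙ
eliminate-pivot B {q} pivot i = trans
  (cong (λ x → B (suc i) q + B (suc i) q * x) pivot)
  (solve 1 (λ x → x :+ x :* con 1ℙ := con 0ℙ) refl (B (suc i) q))

-- Below the pivot column `q` is zero, so every minor that retains this column vanishes.
det-eliminate : ∀ {n} (B : SquareMatrix ℤ₂ (suc n)) {q} → B zero q ≡ 1ℙ →
  det ℤ₂ B ≡ cofactors (eliminate B q) q
det-eliminate B {q} pivot = begin
  det ℤ₂ B                      ≡⟨ det-expand B ⟩
  B zero · cofactors (B ∘ suc)  ≡⟨ det-addFirstRow (B zero) (B ∘ suc) (λ i → B (suc i) q) ⟨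
  B zero · cofactors M          ≡⟨ sum-single (λ j → B zero j * cofactors M j) q other ⟩
  B zero q * cofactors M q      ≡⟨ cong (_* cofactors M q) pivot ⟩
  cofactors M q                 ∎
  where
  M = eliminate B q
  other : ∀ j → j ≢ q → B zero j * cofactors M j ≡ 0ℙ
  other j j≢q = trans (cong (B zero j *_) (det-zeroColumn (removeColumn M j) (punchOut j≢q) λ i →
    trans (cong (M i) (punchIn-punchOut j≢q)) (eliminate-pivot B pivot i))) (ℙ.*-zeroʳ (B zero j))

eliminate-dependent : ∀ {n} (B : SquareMatrix ℤ₂ (suc n)) {q} → B zero q ≡ 1ℙ →
  Dependent (removeColumn (eliminate B q) q) → Dependent B
-- The coefficient `v · c` of the first row accounts for the multiples of it that the elimination
-- added.
eliminate-dependent B {q} pivot (v , (i , vᵢ≡1) , vM≡0) = (v · c ∷ᶠ v) , (suc i , vᵢ≡1) , λ j → begin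
  (v · c) * r j + combination v (B ∘ suc) j
    ≡⟨ solve 3 (λ x y z → x :* y :+ z := z :+ y :* x) refl (v · c) (r j) (combination v (B ∘ suc) j) ⟩
  combination v (B ∘ suc) j + r j * (v · c)
    ≡⟨ ·-linearʳ (λ i → B (suc i) j) (r j) c v ⟨
  v · (λ i → B (suc i) j + r j * c i)
    ≡⟨ ·-cong {u = v} (λ _ → refl) (λ i → cong (B (suc i) j +_) (ℙ.*-comm (r j) (c i))) ⟩
  combination v (eliminate B q) j
    ≡⟨ allColumns j ⟩
  0ℙ ∎
  where
  r = B zero
  c : Vector Parity _
  c i = B (suc i) q
  allColumns : ∀ j → combination v (eliminate B q) j ≡ 0ℙ
  allColumns j with q Fin.≟ j
  ... | yes refl = ·-zeroʳ v (eliminate-pivot B pivot)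
  ... | no  q≢j  = trans (cong (combination v (eliminate B q)) (sym (punchIn-punchOut q≢j))) (vM≡0 (punchOut q≢j))

-- A zero first row is a dependence by itself, and a pivot in it reduces the order by one.
det≡0⇒dependent : ∀ {n} (B : SquareMatrix ℤ₂ n) → det ℤ₂ B ≡ 0ℙ → Dependent B
det≡0⇒dependent {suc n} B det≡0 with any? (λ q → B zero q ℙ.≟ 1ℙ)
... | no r≢1 = unit zero , (zero , refl) , λ j →
  trans (unit-· zero (λ i → B i j)) (≢1⇒≡0 λ r≡1 → r≢1 (j , r≡1))
... | yes (q , pivot) = eliminate-dependent B pivot
  (det≡0⇒dependent (removeColumn (eliminate B q) q) (trans (sym (det-eliminate B pivot)) det≡0))

-- Subsets

enumerate-∈ : ∀ {n} (α : Subset n) i → enumerate α i ∈ α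
enumerate-∈ (outside ∷ α) i       = there (enumerate-∈ α i)
enumerate-∈ (inside  ∷ α) zero    = here
enumerate-∈ (inside  ∷ α) (suc i) = there (enumerate-∈ α i)

enumerate-surjective : ∀ {n} (α : Subset n) {j} → j ∈ α → ∃[ i ] enumerate α i ≡ j
enumerate-surjective (outside ∷ α) (there j∈α) =
  let i , eq = enumerate-surjective α j∈α in i , cong suc eq
enumerate-surjective (inside  ∷ α) here        = zero , refl
enumerate-surjective (inside  ∷ α) (there j∈α) =
  let i , eq = enumerate-surjective α j∈α in suc i , cong suc eq

x∉p-x : ∀ {n} (p : Subset n) {x} → x ∉ p - x
x∉p-x (s ∷ p) {zero}  ()
x∉p-x (s ∷ p) {suc x} (there x∈p-x) = x∉p-x p x∈p-x

p-x⊆p : ∀ {n} (p : Subset n) x → p - x ⊆ p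
p-x⊆p p x = p─q⊆p p ⁅ x ⁆

x∈p⇒1+∣p-x∣≡∣p∣ : ∀ {n} (p : Subset n) {x} → x ∈ p → suc ∣ p - x ∣ ≡ ∣ p ∣
x∈p⇒1+∣p-x∣≡∣p∣ (inside  ∷ p) here        = cong (suc ∘ ∣_∣) (p─⊥≡p p)
x∈p⇒1+∣p-x∣≡∣p∣ (inside  ∷ p) (there x∈p) = cong suc (x∈p⇒1+∣p-x∣≡∣p∣ p x∈p)
x∈p⇒1+∣p-x∣≡∣p∣ (outside ∷ p) (there x∈p) = x∈p⇒1+∣p-x∣≡∣p∣ p x∈p

∣p∪⁅x⁆∣≤1+∣p∣ : ∀ {n} (p : Subset n) x → ∣ p ∪ ⁅ x ⁆ ∣ ≤ suc ∣ p ∣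
∣p∪⁅x⁆∣≤1+∣p∣ (inside  ∷ p) zero    = s≤s (m≤n⇒m≤1+n (≤-reflexive (cong ∣_∣ (∪-identityʳ p))))
∣p∪⁅x⁆∣≤1+∣p∣ (outside ∷ p) zero    = s≤s (≤-reflexive (cong ∣_∣ (∪-identityʳ p)))
∣p∪⁅x⁆∣≤1+∣p∣ (inside  ∷ p) (suc x) = s≤s (∣p∪⁅x⁆∣≤1+∣p∣ p x)
∣p∪⁅x⁆∣≤1+∣p∣ (outside ∷ p) (suc x) = ∣p∪⁅x⁆∣≤1+∣p∣ p x

superset : ∀ {n} (p : Subset n) m → ∣ p ∣ ≤ m → m ≤ n → ∃[ q ] (p ⊆ q × ∣ q ∣ ≡ m)
superset []            zero    _         _         = [] , (λ x∈p → x∈p) , refl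
superset (inside  ∷ p) (suc m) (s≤s p≤m) (s≤s m≤n) =
  let q , p⊆q , ∣q∣≡m = superset p m p≤m m≤n in
  inside ∷ q , (λ { here → here ; (there x∈p) → there (p⊆q x∈p) }) , cong suc ∣q∣≡m
superset {suc n} (outside ∷ p) m p≤m m≤1+n with m≤n⇒m<n∨m≡n m≤1+n
... | inj₁ (s≤s m≤n) =
  let q , p⊆q , ∣q∣≡m = superset p m p≤m m≤n in
  outside ∷ q , (λ { (there x∈p) → there (p⊆q x∈p) }) , ∣q∣≡m
... | inj₂ refl = ⊤ , ⊆⊤ , ∣⊤∣≡n (suc n)

-- Principal minors and kernel vectors

VanishesOff : ∀ {n} → Subset n → Vector Parity n → Set
VanishesOff α v = ∀ i → i ∉ α → v i ≡ 0ℙ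

vanishesOff-∈ : ∀ {n} {α : Subset n} {v} → VanishesOff α v → ∀ {i} → v i ≡ 1ℙ → i ∈ α
vanishesOff-∈ {α = α} v≡0 {i} vᵢ≡1 with i ∈? α
... | yes i∈α = i∈α
... | no  i∉α = contradiction (trans (sym vᵢ≡1) (v≡0 i i∉α)) 1≢0

sum-enumerate : ∀ {n} (α : Subset n) {f} → VanishesOff α f → sum f ≡ sum (f ∘ enumerate α)
sum-enumerate []            f≡0 = refl
sum-enumerate (outside ∷ α) {f} f≡0 = cong₂ _+_ (f≡0 zero λ ()) (sum-enumerate α λ i i∉α → f≡0 (suc i) λ { (there i∈α) → i∉α i∈α })
sum-enumerate (inside  ∷ α) {f} f≡0 = cong (f zero +_) (sum-enumerate α λ i i∉α → f≡0 (suc i) λ { (there i∈α) → i∉α i∈α })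

·-enumerate : ∀ {n} (α : Subset n) {u v} → VanishesOff α v → u · v ≡ (u ∘ enumerate α) · (v ∘ enumerate α)
·-enumerate α {u} {v} v≡0 = sum-enumerate α {λ i → u i * v i} λ i i∉α → trans (cong (u i *_) (v≡0 i i∉α)) (ℙ.*-zeroʳ (u i))

extend : ∀ {n} (α : Subset n) → Vector Parity ∣ α ∣ → Vector Parity n
extend (outside ∷ α) u zero    = 0ℙ
extend (outside ∷ α) u (suc i) = extend α u i
extend (inside  ∷ α) u zero    = u zero
extend (inside  ∷ α) u (suc i) = extend α (u ∘ suc) i

extend-vanishesOff : ∀ {n} (α : Subset n) u → VanishesOff α (extend α u)
extend-vanishesOff (outside ∷ α) u zero    _   = refl
extend-vanishesOff (outside ∷ α) u (suc i) i∉α = extend-vanishesOff α u i (i∉α ∘ there)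
extend-vanishesOff (inside  ∷ α) u zero    i∉α = contradiction here i∉α
extend-vanishesOff (inside  ∷ α) u (suc i) i∉α = extend-vanishesOff α (u ∘ suc) i (i∉α ∘ there)

extend-enumerate : ∀ {n} (α : Subset n) u i → extend α u (enumerate α i) ≡ u i
extend-enumerate (outside ∷ α) u i       = extend-enumerate α u i
extend-enumerate (inside  ∷ α) u zero    = refl
extend-enumerate (inside  ∷ α) u (suc i) = extend-enumerate α (u ∘ suc) i

·-extend : ∀ {n} (α : Subset n) u v → u · extend α v ≡ (u ∘ enumerate α) · v
·-extend α u v = trans (·-enumerate α {u} (extend-vanishesOff α v)) (·-cong {u = u ∘ enumerate α} (λ _ → refl) (extend-enumerate α v))

-- Kernel vectors of a principal submatrix are kept at full length, zero off `α`, so that vectors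
-- for different subsets can be added and compared.
Singular : ∀ {n} → SquareMatrix ℤ₂ n → Subset n → Set
Singular B α = ∃[ v ] (VanishesOff α v × (∃[ i ] v i ≡ 1ℙ) × ∀ i → i ∈ α → B i · v ≡ 0ℙ)

-- Take for `u` the cofactors along the first row: that row pairs with them to the determinant, any
-- other row to a determinant with a repeated row. The order is a successor only up to an equation,
-- as is the case for `∣ α ∣`.
first-cofactors : ∀ {n m} → n ≡ suc m → (C : SquareMatrix ℤ₂ n) → det ℤ₂ C ≡ 1ℙ →
  ∃[ i ] ∃[ u ] (C i · u ≡ 1ℙ × ∀ j → j ≢ i → C j · u ≡ 0ℙ)
first-cofactors refl C det≡1 = zero , cofactors (C ∘ suc) , trans (sym (det-expand C)) det≡1 , λ
  { zero    0≢0 → contradiction refl 0≢0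
  ; (suc j) _   → ·-cofactors-row (C ∘ suc) j }

module _ {n} {B : SquareMatrix ℤ₂ n} (sym-B : Symmetric ℤ₂ B) where

  -- A zero determinant gives a dependence of rows; symmetry turns it into a kernel vector.
  minor≡0⇒singular : ∀ α → principalMinor ℤ₂ B α ≡ 0ℙ → Singular B α
  minor≡0⇒singular α minor≡0 =
    let c , (k , cₖ≡1) , cC≡0 = det≡0⇒dependent (principalSubmatrix ℤ₂ B α) minor≡0
        kernel : ∀ l → B (enumerate α l) · extend α c ≡ 0ℙ
        kernel l = begin
          B (enumerate α l) · extend α c              ≡⟨ ·-extend α (B (enumerate α l)) c ⟩
          (B (enumerate α l) ∘ enumerate α) · c       ≡⟨ ·-comm _ c ⟩
          c · (B (enumerate α l) ∘ enumerate α)       ≡⟨ ·-cong {u = c} (λ _ → refl) (λ m → sym-B (enumerate α l) (enumerate α m)) ⟩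
          combination c (principalSubmatrix ℤ₂ B α) l ≡⟨ cC≡0 l ⟩
          0ℙ                                          ∎
    in extend α c , extend-vanishesOff α c , (enumerate α k , trans (extend-enumerate α c k) cₖ≡1) ,
       λ i i∈α → let l , eq = enumerate-surjective α i∈α in trans (cong (λ i → B i · extend α c) (sym eq)) (kernel l)

  singular⇒minor≡0 : ∀ α → Singular B α → principalMinor ℤ₂ B α ≡ 0ℙ
  singular⇒minor≡0 α (v , v≡0 , (i , vᵢ≡1) , Bv≡0) =
    let k , eq = enumerate-surjective α (vanishesOff-∈ v≡0 vᵢ≡1) in
    dependent⇒det≡0 (principalSubmatrix ℤ₂ B α) (v ∘ enumerate α , (k , trans (cong v eq) vᵢ≡1) , λ l → begin
      combination (v ∘ enumerate α) (principalSubmatrix ℤ₂ B α) l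
        ≡⟨ ·-comm (v ∘ enumerate α) _ ⟩
      (λ m → B (enumerate α m) (enumerate α l)) · (v ∘ enumerate α)
        ≡⟨ ·-cong {v = v ∘ enumerate α} (λ m → sym-B (enumerate α m) (enumerate α l)) (λ _ → refl) ⟩
      (B (enumerate α l) ∘ enumerate α) · (v ∘ enumerate α)
        ≡⟨ ·-enumerate α {B (enumerate α l)} v≡0 ⟨
      B (enumerate α l) · v
        ≡⟨ Bv≡0 (enumerate α l) (enumerate-∈ α l) ⟩
      0ℙ ∎)

  minor≡0-zeroRow : ∀ α {i} → i ∈ α → (∀ j → B j i ≡ 0ℙ) → principalMinor ℤ₂ B α ≡ 0ℙ
  minor≡0-zeroRow α {i} i∈α B≡0 = singular⇒minor≡0 α (unit i ,
    (λ j j∉α → unit-off {i = i} λ { refl → j∉α i∈α }) , (i , unit-diag i) , λ j _ →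
    trans (·-comm (B j) (unit i)) (trans (unit-· i (B j)) (B≡0 j)))

  solve-unit : ∀ α {m} → ∣ α ∣ ≡ suc m → principalMinor ℤ₂ B α ≢ 0ℙ →
    ∃[ i ] ∃[ v ] (i ∈ α × VanishesOff α v × B i · v ≡ 1ℙ × ∀ j → j ∈ α → j ≢ i → B j · v ≡ 0ℙ)
  solve-unit α ∣α∣≡1+m minor≢0 =
    let k , u , Cu≡1 , Cu≡0 = first-cofactors ∣α∣≡1+m (principalSubmatrix ℤ₂ B α) (≢0⇒≡1 minor≢0)
        away : ∀ l → enumerate α l ≢ enumerate α k → B (enumerate α l) · extend α u ≡ 0ℙ
        away l l≢k = trans (·-extend α (B (enumerate α l)) u) (Cu≡0 l (l≢k ∘ cong (enumerate α)))
    in enumerate α k , extend α u , enumerate-∈ α k , extend-vanishesOff α u ,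
       trans (·-extend α (B (enumerate α k)) u) Cu≡1 ,
       λ j j∈α j≢i → case enumerate-surjective α j∈α of λ { (l , refl) → away l j≢i }

  adjoint : ∀ u v → u · (λ i → B i · v) ≡ v · (λ i → B i · u)
  adjoint u v = begin
    u · (λ i → B i · v)   ≡⟨ combination-assoc u B v ⟨
    combination u B · v   ≡⟨ ·-comm (combination u B) v ⟩
    v · combination u B   ≡⟨ ·-cong {u = v} (λ _ → refl)
                            (λ j → trans (·-comm u (λ i → B i j)) (·-cong {v = u} (λ i → sym-B i j) (λ _ → refl))) ⟩
    v · (λ i → B i · u)   ∎

-- Alternating matrices

ZeroDiagonal : ∀ {n} → SquareMatrix ℤ₂ n → Set
ZeroDiagonal B = ∀ i → B i i ≡ 0ℙ

-- Splitting off the first coordinate leaves a diagonal term, which is zero, two equal cross terms,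
-- which cancel, and the form on the remaining coordinates.
isotropic : ∀ {n} {B : SquareMatrix ℤ₂ n} → Symmetric ℤ₂ B → ZeroDiagonal B →
  ∀ v → v · (λ i → B i · v) ≡ 0ℙ
isotropic {zero}      sym-B diag v = refl
isotropic {suc n} {B} sym-B diag v = begin
  v zero * (B zero zero * v zero + r · w) + w · (λ i → B (suc i) zero * v zero + B (suc i) ∘ suc · w)
    ≡⟨ cong₂ (λ x y → v zero * (x * v zero + r · w) + y) (diag zero)
        (·-cong {u = w} (λ _ → refl) (λ i → trans (ℙ.+-comm (B (suc i) zero * v zero) _) (cong (B (suc i) ∘ suc · w +_)
          (trans (ℙ.*-comm _ (v zero)) (cong (v zero *_) (sym-B (suc i) zero)))))) ⟩
  v zero * (r · w) + w · ((λ i → B (suc i) ∘ suc · w) +[ v zero ] r)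
    ≡⟨ cong (v zero * (r · w) +_) (·-linearʳ (λ i → B (suc i) ∘ suc · w) (v zero) r w) ⟩
  v zero * (r · w) + (w · (λ i → B (suc i) ∘ suc · w) + v zero * (w · r))
    ≡⟨ cong₂ (λ x y → v zero * (r · w) + (x + v zero * y)) (isotropic (λ i j → sym-B (suc i) (suc j)) (diag ∘ suc) w) (·-comm w r) ⟩
  v zero * (r · w) + v zero * (r · w)
    ≡⟨ p+p≡0ℙ (v zero * (r · w)) ⟩
  0ℙ ∎
  where
  w = v ∘ suc
  r = B zero ∘ suc

-- Defined so that `double (suc k)` unfolds to two successors, matching the removal of indices and
-- the reading of letters in pairs.
double : ℕ → ℕ
double zero    = zero
double (suc k) = suc (suc (double k))

module _ {n} {B : SquareMatrix ℤ₂ n} (sym-B : Symmetric ℤ₂ B) (diag-B : ZeroDiagonal B) where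

  -- With i and v such that B v is the unit vector i on α, any j in the support of v will do.
  nonsingular-remove₂ : ∀ α {m} → ∣ α ∣ ≡ suc m → principalMinor ℤ₂ B α ≢ 0ℙ →
    ∃[ i ] ∃[ j ] (i ∈ α × j ∈ α - i × principalMinor ℤ₂ B (α - i - j) ≢ 0ℙ)
  nonsingular-remove₂ α ∣α∣≡1+m minor≢0 with solve-unit sym-B α ∣α∣≡1+m minor≢0
  ... | i , v , i∈α , v≡0 , Bvᵢ≡1 , Bv≡0 with any? (λ j → v j ℙ.≟ 1ℙ)
  ...   | no v≢1 = contradiction (trans (sym Bvᵢ≡1) (·-zeroʳ (B i) λ j → ≢1⇒≡0 λ vⱼ≡1 → v≢1 (j , vⱼ≡1))) 1≢0
  ...   | yes (j , vⱼ≡1) = i , j , i∈α , j∈α-i , λ minor≡0 → nonsingular (minor≡0⇒singular sym-B (α - i - j) minor≡0)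
    where
    -- On `α`, `B v` is the unit vector at `i`, so pairing with it reads off the entry at `i`.
    pairing : ∀ w → VanishesOff α w → w · (λ k → B k · v) ≡ w i
    pairing w w≡0 = trans (sum-single (λ k → w k * (B k · v)) i other) (trans (cong (w i *_) Bvᵢ≡1) (ℙ.*-identityʳ (w i)))
      where
      other : ∀ k → k ≢ i → w k * (B k · v) ≡ 0ℙ
      other k k≢i with k ∈? α
      ... | yes k∈α = trans (cong (w k *_) (Bv≡0 k k∈α k≢i)) (ℙ.*-zeroʳ (w k))
      ... | no  k∉α = cong (_* (B k · v)) (w≡0 k k∉α)

    vᵢ≡0 : v i ≡ 0ℙ
    vᵢ≡0 = trans (sym (pairing v v≡0)) (isotropic sym-B diag-B v)

    j∈α-i : j ∈ α - i
    j∈α-i = x∈p∧x≢y⇒x∈p-y (vanishesOff-∈ v≡0 vⱼ≡1) λ { refl → 1≢0 (trans (sym vⱼ≡1) vᵢ≡0) }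

    nonsingular : ¬ Singular B (α - i - j)
    nonsingular (w , w≡0 , (k , wₖ≡1) , Bw≡0) = minor≢0 (singular⇒minor≡0 sym-B α (kernel (B i · w) refl))
      where
      w-off-α : VanishesOff α w
      w-off-α l l∉α = w≡0 l (l∉α ∘ p-x⊆p α i ∘ p-x⊆p (α - i) j)
      wᵢ≡0 : w i ≡ 0ℙ
      wᵢ≡0 = w≡0 i (x∉p-x α ∘ p-x⊆p (α - i) j)
      wⱼ≡0 : w j ≡ 0ℙ
      wⱼ≡0 = w≡0 j (x∉p-x (α - i))
      other : ∀ l → l ≢ j → v l * (B l · w) ≡ 0ℙ
      other l l≢j with l ∈? α | l Fin.≟ i
      ... | no  l∉α | _        = cong (_* (B l · w)) (v≡0 l l∉α)
      ... | yes _   | yes refl = cong (_* (B l · w)) vᵢ≡0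
      ... | yes l∈α | no  l≢i  = trans (cong (v l *_) (Bw≡0 l (x∈p∧x≢y⇒x∈p-y (x∈p∧x≢y⇒x∈p-y l∈α l≢i) l≢j))) (ℙ.*-zeroʳ (v l))
      -- Only the index `j` contributes to the pairing of `v` with `B w`; by symmetry the same value
      -- is `w i`, which is 0.
      Bwⱼ≡0 : B j · w ≡ 0ℙ
      Bwⱼ≡0 = begin
        B j · w                 ≡⟨ cong (_* (B j · w)) vⱼ≡1 ⟨
        v j * (B j · w)         ≡⟨ sum-single (λ l → v l * (B l · w)) j other ⟨
        v · (λ l → B l · w)     ≡⟨ adjoint sym-B v w ⟩
        w · (λ l → B l · v)     ≡⟨ pairing w w-off-α ⟩
        w i                     ≡⟨ wᵢ≡0 ⟩
        0ℙ                      ∎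
      Bw≡0-off-i : ∀ l → l ∈ α → l ≢ i → B l · w ≡ 0ℙ
      Bw≡0-off-i l l∈α l≢i with l Fin.≟ j
      ... | yes refl = Bwⱼ≡0
      ... | no  l≢j  = Bw≡0 l (x∈p∧x≢y⇒x∈p-y (x∈p∧x≢y⇒x∈p-y l∈α l≢i) l≢j)
      -- If the product is 1 at `i`, adding `v` to `w` cancels it. The sum is nonzero because its
      -- entry at `j` is 1.
      kernel : ∀ c → B i · w ≡ c → Singular B α
      kernel 0ℙ Bwᵢ≡0 = w , w-off-α , (k , wₖ≡1) , all
        where
        all : ∀ l → l ∈ α → B l · w ≡ 0ℙ
        all l l∈α with l Fin.≟ i
        ... | yes refl = Bwᵢ≡0
        ... | no  l≢i  = Bw≡0-off-i l l∈α l≢i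
      kernel 1ℙ Bwᵢ≡1 = w +[ 1ℙ ] v , (λ l l∉α → cong₂ _+_ (w-off-α l l∉α) (v≡0 l l∉α)) ,
        (j , cong₂ _+_ wⱼ≡0 vⱼ≡1) , λ l l∈α → trans (·-linearʳ w 1ℙ v (B l)) (all l l∈α)
        where
        all : ∀ l → l ∈ α → B l · w + B l · v ≡ 0ℙ
        all l l∈α with l Fin.≟ i
        ... | yes refl = cong₂ _+_ Bwᵢ≡1 Bvᵢ≡1
        ... | no  l≢i  = cong₂ _+_ (Bw≡0-off-i l l∈α l≢i) (Bv≡0 l l∈α l≢i)

  -- The equations `∣ α ∣ ≡ suc m` and `suc ∣ β ∣ ≡ m` also cover order 1, where the second becomes
  -- absurd.
  remove₂-nonzero : ∀ {m} α → ∣ α ∣ ≡ suc m → principalMinor ℤ₂ B α ≢ 0ℙ →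
    ∃[ β ] (suc ∣ β ∣ ≡ m × principalMinor ℤ₂ B β ≢ 0ℙ)
  remove₂-nonzero α ∣α∣≡1+m minor≢0 =
    let i , j , i∈α , j∈α-i , minor′≢0 = nonsingular-remove₂ α ∣α∣≡1+m minor≢0 in
    α - i - j , suc-injective (trans (cong suc (x∈p⇒1+∣p-x∣≡∣p∣ (α - i) j∈α-i)) (trans (x∈p⇒1+∣p-x∣≡∣p∣ α i∈α) ∣α∣≡1+m)) , minor′≢0

  someNonzero-descend : ∀ k → SomeNonzero ℤ₂ B (suc (suc k)) → SomeNonzero ℤ₂ B k
  someNonzero-descend k (α , ∣α∣≡2+k , minor≢0) =
    let β , 1+∣β∣≡1+k , minor′≢0 = remove₂-nonzero α ∣α∣≡2+k minor≢0 in β , suc-injective 1+∣β∣≡1+k , minor′≢0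

  -- A nonzero minor of odd order would descend in steps of two to order 1, where no two indices are
  -- left to remove.
  odd-allZero : ∀ k → AllZero ℤ₂ B (suc (double k))
  odd-allZero k α ∣α∣≡ with principalMinor ℤ₂ B α ℙ.≟ 0ℙ
  ... | yes minor≡0 = minor≡0
  odd-allZero zero    α ∣α∣≡1 | no minor≢0 with remove₂-nonzero α ∣α∣≡1 minor≢0
  ... | _ , () , _
  odd-allZero (suc k) α ∣α∣≡ | no minor≢0 =
    let β , 1+∣β∣≡ , minor′≢0 = remove₂-nonzero α ∣α∣≡ minor≢0 in
    contradiction (odd-allZero k β (suc-injective 1+∣β∣≡)) minor′≢0

  allZero-ascend : ∀ k → AllZero ℤ₂ B k → AllZero ℤ₂ B (suc (suc k))
  allZero-ascend k all≡0 α ∣α∣≡ with principalMinor ℤ₂ B α ℙ.≟ 0ℙ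
  ... | yes minor≡0 = minor≡0
  ... | no  minor≢0 =
    let β , ∣β∣≡k , minor′≢0 = someNonzero-descend k (α , ∣α∣≡ , minor≢0) in contradiction (all≡0 β ∣β∣≡k) minor′≢0

-- Complete graphs and orders whose minors are all nonzero.

Complete : ∀ {n} → SquareMatrix ℤ₂ n → Set
Complete B = ∀ i j → i ≢ j → B i j ≡ 1ℙ

sum-even-constant : ∀ {m} k → m ≡ double k → ∀ c → (f : Vector Parity m) → (∀ i → f i ≡ c) → sum f ≡ 0ℙ
sum-even-constant zero    refl c f f≡c = refl
sum-even-constant (suc k) refl c f f≡c = begin
  f zero + (f (suc zero) + sum (λ i → f (suc (suc i))))
    ≡⟨ cong₂ _+_ (f≡c zero) (cong₂ _+_ (f≡c (suc zero)) (sum-even-constant k refl c (λ i → f (suc (suc i))) (λ i → f≡c (suc (suc i))))) ⟩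
  c + (c + 0ℙ)
    ≡⟨ solve 1 (λ c → c :+ (c :+ con 0ℙ) := con 0ℙ) refl c ⟩
  0ℙ ∎

subset-of-size : ∀ {n m} → m ≤ n → ∃[ α ] (∣_∣ {n} α ≡ m)
subset-of-size {n} m≤n =
  let α , _ , ∣α∣≡m = superset ⊥ _ (≤-trans (≤-reflexive (∣⊥∣≡0 n)) z≤n) m≤n in α , ∣α∣≡m

-- The only nonzero vector on a singleton is the unit vector, so its being in the kernel makes the
-- diagonal entry zero.
allZero₁⇒zeroDiagonal : ∀ {n} {B : SquareMatrix ℤ₂ n} → Symmetric ℤ₂ B → AllZero ℤ₂ B 1 → ZeroDiagonal B
allZero₁⇒zeroDiagonal {B = B} sym-B all≡0 i
  with minor≡0⇒singular sym-B ⁅ i ⁆ (all≡0 ⁅ i ⁆ (∣⁅x⁆∣≡1 i))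
... | v , v≡0 , (j , vⱼ≡1) , Bv≡0 with x∈⁅y⁆⇒x≡y i (vanishesOff-∈ v≡0 vⱼ≡1)
...   | refl = begin
  B i i          ≡⟨ ℙ.*-identityʳ (B i i) ⟨
  B i i * 1ℙ     ≡⟨ cong (B i i *_) vⱼ≡1 ⟨
  B i i * v i    ≡⟨ sum-single (λ k → B i k * v k) i (λ k k≢i → trans (cong (B i k *_) (v≡0 k (k≢i ∘ x∈⁅y⁆⇒x≡y i))) (ℙ.*-zeroʳ (B i k))) ⟨
  B i · v        ≡⟨ Bv≡0 i (x∈⁅x⁆ i) ⟩
  0ℙ             ∎

module _ {n} {B : SquareMatrix ℤ₂ n} (sym-B : Symmetric ℤ₂ B) (diag-B : ZeroDiagonal B) where

  -- `B` is the all-ones matrix plus the identity, so a kernel vector on `α` has every entry on `α`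
  -- equal to its own sum. That sum has evenly many equal terms and vanishes, and with it the
  -- vector.
  complete⇒allNonzero : Complete B → ∀ k → AllNonzero ℤ₂ B (double k)
  complete⇒allNonzero complete k α ∣α∣≡2k minor≡0 with minor≡0⇒singular sym-B α minor≡0
  ... | v , v≡0 , (i , vᵢ≡1) , Bv≡0 = contradiction (begin
    1ℙ           ≡⟨ vᵢ≡1 ⟨
    v i          ≡⟨ constant i (vanishesOff-∈ v≡0 vᵢ≡1) ⟩
    sum v        ≡⟨ sum-enumerate α v≡0 ⟩
    sum (v ∘ enumerate α) ≡⟨ sum-even-constant k ∣α∣≡2k (sum v) (v ∘ enumerate α) (λ l → constant _ (enumerate-∈ α l)) ⟩
    0ℙ           ∎) 1≢0
    where
    off-diagonal : ∀ i j → B i j + unit i j ≡ 1ℙ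
    off-diagonal i j with i Fin.≟ j
    ... | yes refl = cong₂ _+_ (diag-B i) (unit-diag i)
    ... | no  i≢j  = cong₂ _+_ (complete i j i≢j) (unit-off {i = i} (i≢j ∘ sym))
    row : ∀ i → B i · v + v i ≡ sum v
    row i = begin
      B i · v + v i                           ≡⟨ cong (B i · v +_) (unit-· i v) ⟨
      B i · v + unit i · v                    ≡⟨ ·-linearˡ (B i) 1ℙ (unit i) v ⟨
      (sum λ j → (B i j + unit i j) * v j)    ≡⟨ sum-cong-≗ (λ j → cong (_* v j) (off-diagonal i j)) ⟩
      sum v                                   ∎
    constant : ∀ i → i ∈ α → v i ≡ sum v
    constant i i∈α = trans (cong (_+ v i) (sym (Bv≡0 i i∈α))) (row i)

  -- The kernel vectors of a principal submatrix of order 2k + 1 have full support,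
  -- since a zero entry would give a kernel vector of a submatrix of order 2k.
  kernel-ones : ∀ k → AllNonzero ℤ₂ B (double k) → ∀ α → ∣ α ∣ ≡ suc (double k) →
    ∃[ v ] (VanishesOff α v × (∀ i → i ∈ α → v i ≡ 1ℙ) × ∀ i → i ∈ α → B i · v ≡ 0ℙ)
  kernel-ones k all≢0 α ∣α∣≡ with minor≡0⇒singular sym-B α (odd-allZero sym-B diag-B k α ∣α∣≡)
  ... | v , v≡0 , nonzero , Bv≡0 = v , v≡0 , ones , Bv≡0
    where
    ones : ∀ i → i ∈ α → v i ≡ 1ℙ
    ones i i∈α = ≢0⇒≡1 λ vᵢ≡0 → all≢0 (α - i) (suc-injective (trans (x∈p⇒1+∣p-x∣≡∣p∣ α i∈α) ∣α∣≡))
      (singular⇒minor≡0 sym-B (α - i) (v , off vᵢ≡0 , nonzero , λ j → Bv≡0 j ∘ p-x⊆p α i))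
      where
      off : v i ≡ 0ℙ → VanishesOff (α - i) v
      off vᵢ≡0 j j∉α-i with j Fin.≟ i
      ... | yes refl = vᵢ≡0
      ... | no  j≢i  = v≡0 j λ j∈α → j∉α-i (x∈p∧x≢y⇒x∈p-y j∈α j≢i)

  module _ k (all≢0 : AllNonzero ℤ₂ B (double (suc k))) (2k+4≤n : double (suc (suc k)) ≤ n) where

    private
      -- Take `V` of order 2k + 4 containing all three indices. The kernel vectors on `V - l` and
      -- `V - l′` are all ones, so they differ by the sum of the unit vectors at `l` and `l′`; row
      -- `i` annihilates both because `i` lies in both subsets.
      exchange : ∀ {i l l′} → i ≢ l → i ≢ l′ → l ≢ l′ → B i l ≡ B i l′
      exchange {i} {l} {l′} i≢l i≢l′ l≢l′ = p+q≡0⇒p≡q (B i l) (B i l′) (begin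
        B i l + B i l′                     ≡⟨ cong₂ _+_ (trans (·-comm (B i) (unit l)) (unit-· l (B i)))
                                              (trans (·-comm (B i) (unit l′)) (unit-· l′ (B i))) ⟨
        B i · unit l + B i · unit l′       ≡⟨ ·-linearʳ (unit l) 1ℙ (unit l′) (B i) ⟨
        B i · (unit l +[ 1ℙ ] unit l′)     ≡⟨ ·-cong {u = B i} (λ _ → refl) difference ⟨
        B i · (v +[ 1ℙ ] v′)               ≡⟨ ·-linearʳ v 1ℙ v′ (B i) ⟩
        B i · v + B i · v′                 ≡⟨ cong₂ _+_ (Bv≡0 i (x∈p∧x≢y⇒x∈p-y i∈V i≢l)) (Bv′≡0 i (x∈p∧x≢y⇒x∈p-y i∈V i≢l′)) ⟩
        0ℙ                                 ∎)
        where
        size : ∣ (⁅ i ⁆ ∪ ⁅ l ⁆) ∪ ⁅ l′ ⁆ ∣ ≤ double (suc (suc k))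
        size = ≤-trans (∣p∪⁅x⁆∣≤1+∣p∣ (⁅ i ⁆ ∪ ⁅ l ⁆) l′)
          (s≤s (≤-trans (∣p∪⁅x⁆∣≤1+∣p∣ ⁅ i ⁆ l) (s≤s (≤-trans (≤-reflexive (∣⁅x⁆∣≡1 i)) (s≤s z≤n)))))
        extension = superset _ _ size 2k+4≤n
        V = proj₁ extension
        ⊆V = proj₁ (proj₂ extension)
        ∣V∣≡ = proj₂ (proj₂ extension)
        i∈V : i ∈ V
        i∈V = ⊆V (p⊆p∪q ⁅ l′ ⁆ (p⊆p∪q ⁅ l ⁆ (x∈⁅x⁆ i)))
        l∈V : l ∈ V
        l∈V = ⊆V (p⊆p∪q ⁅ l′ ⁆ (q⊆p∪q ⁅ i ⁆ ⁅ l ⁆ (x∈⁅x⁆ l)))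
        l′∈V : l′ ∈ V
        l′∈V = ⊆V (q⊆p∪q (⁅ i ⁆ ∪ ⁅ l ⁆) ⁅ l′ ⁆ (x∈⁅x⁆ l′))
        K  = kernel-ones (suc k) all≢0 (V - l) (suc-injective (trans (x∈p⇒1+∣p-x∣≡∣p∣ V l∈V) ∣V∣≡))
        K′ = kernel-ones (suc k) all≢0 (V - l′) (suc-injective (trans (x∈p⇒1+∣p-x∣≡∣p∣ V l′∈V) ∣V∣≡))
        v  = proj₁ K
        v′ = proj₁ K′
        v≡0  = proj₁ (proj₂ K)
        v′≡0 = proj₁ (proj₂ K′)
        v≡1  = proj₁ (proj₂ (proj₂ K))
        v′≡1 = proj₁ (proj₂ (proj₂ K′))
        Bv≡0  = proj₂ (proj₂ (proj₂ K))
        Bv′≡0 = proj₂ (proj₂ (proj₂ K′))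
        difference : ∀ j → v j + v′ j ≡ unit l j + unit l′ j
        difference j with j Fin.≟ l | j Fin.≟ l′
        ... | yes refl | yes refl = contradiction refl l≢l′
        ... | yes refl | no  l≢l′ = trans (cong₂ _+_ (v≡0 l (x∉p-x V)) (v′≡1 l (x∈p∧x≢y⇒x∈p-y l∈V l≢l′)))
          (sym (cong₂ _+_ (unit-diag l) (unit-off {i = l′} l≢l′)))
        ... | no  l′≢l | yes refl = trans (cong₂ _+_ (v≡1 l′ (x∈p∧x≢y⇒x∈p-y l′∈V l′≢l)) (v′≡0 l′ (x∉p-x V)))
          (sym (cong₂ _+_ (unit-off {i = l} l′≢l) (unit-diag l′)))
        ... | no  j≢l  | no  j≢l′ = trans (equal (j ∈? V)) (sym (cong₂ _+_ (unit-off {i = l} j≢l) (unit-off {i = l′} j≢l′)))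
          where
          equal : Dec (j ∈ V) → v j + v′ j ≡ 0ℙ
          equal (yes j∈V) = cong₂ _+_ (v≡1 j (x∈p∧x≢y⇒x∈p-y j∈V j≢l)) (v′≡1 j (x∈p∧x≢y⇒x∈p-y j∈V j≢l′))
          equal (no  j∉V) = cong₂ _+_ (v≡0 j (j∉V ∘ p-x⊆p V l)) (v′≡0 j (j∉V ∘ p-x⊆p V l′))

      row-constant : ∀ {i l l′} → i ≢ l → i ≢ l′ → B i l ≡ B i l′
      row-constant {i} {l} {l′} i≢l i≢l′ with l Fin.≟ l′
      ... | yes refl = refl
      ... | no  l≢l′ = exchange i≢l i≢l′ l≢l′

      constant : ∀ {i j p q} → i ≢ j → p ≢ q → B i j ≡ B p q
      constant {i} {j} {p} {q} i≢j p≢q with p Fin.≟ i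
      ... | yes refl = row-constant i≢j p≢q
      ... | no  p≢i  = begin
        B i j  ≡⟨ row-constant i≢j (p≢i ∘ sym) ⟩
        B i p  ≡⟨ sym-B i p ⟩
        B p i  ≡⟨ row-constant p≢i p≢q ⟩
        B p q  ∎

    -- Off-diagonal entries are all equal. Were they 0, column `i` would vanish, and with it any
    -- minor of order 2k + 2 whose subset contains `i`.
    allNonzero⇒complete : Complete B
    allNonzero⇒complete i j i≢j = ≢0⇒≡1 λ Bᵢⱼ≡0 →
      let α , i∈α , ∣α∣≡ = superset ⁅ i ⁆ (double (suc k)) (≤-trans (≤-reflexive (∣⁅x⁆∣≡1 i)) (s≤s z≤n))
                                    (≤-trans (m≤n⇒m≤1+n (m≤n⇒m≤1+n ≤-refl)) 2k+4≤n)
      in all≢0 α ∣α∣≡ (minor≡0-zeroRow sym-B α (i∈α (x∈⁅x⁆ i)) (column Bᵢⱼ≡0))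
      where
      column : B i j ≡ 0ℙ → ∀ l → B l i ≡ 0ℙ
      column Bᵢⱼ≡0 l with l Fin.≟ i
      ... | yes refl = diag-B i
      ... | no  l≢i  = trans (constant l≢i i≢j) Bᵢⱼ≡0

-- Reading the sequence term by term.

-- Terms B k s: the terms of epr(B) from index k + 1 on begin with s.
Terms : ∀ {n} → SquareMatrix ℤ₂ n → ℕ → List Letter → Set
Terms B k []      = Unit
Terms B k (x ∷ s) = IsTerm ℤ₂ B (suc k) x × Terms B (suc k) s

lookup⇒terms : ∀ {n} {B : SquareMatrix ℤ₂ n} k s →
  (∀ i → IsTerm ℤ₂ B (suc (toℕ i ℕ.+ k)) (lookup s i)) → Terms B k s
lookup⇒terms         k []      term = tt
lookup⇒terms {B = B} k (x ∷ s) term = term zero , lookup⇒terms (suc k) s λ i →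
  subst (λ m → IsTerm ℤ₂ B (suc m) (lookup s i)) (sym (+-suc (toℕ i) k)) (term (suc i))

terms⇒lookup : ∀ {n} {B : SquareMatrix ℤ₂ n} k s → Terms B k s →
  ∀ i → IsTerm ℤ₂ B (suc (toℕ i ℕ.+ k)) (lookup s i)
terms⇒lookup         k (x ∷ s) (term , terms) zero    = term
terms⇒lookup {B = B} k (x ∷ s) (term , terms) (suc i) =
  subst (λ m → IsTerm ℤ₂ B (suc m) (lookup s i)) (+-suc (toℕ i) k) (terms⇒lookup (suc k) s terms i)

isEpr⇒terms : ∀ s {B} → IsEpr ℤ₂ s B → Terms B 0 s
isEpr⇒terms s {B} epr = lookup⇒terms 0 s λ i →
  subst (λ m → IsTerm ℤ₂ B (suc m) (lookup s i)) (sym (ℕ.+-identityʳ (toℕ i))) (epr i)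

-- The order `n` is tied to the length of `s` by an equation, since the matrices below come with
-- orders dictated by their construction.
attainable : ∀ {n s} → s ≢ [] → length s ≡ n → (B : SquareMatrix ℤ₂ n) → Symmetric ℤ₂ B → Terms B 0 s → Attainable ℤ₂ s
attainable {s = s} s≢[] refl B sym-B terms = s≢[] , B , sym-B , λ i →
  subst (λ m → IsTerm ℤ₂ B (suc m) (lookup s i)) (ℕ.+-identityʳ (toℕ i)) (terms⇒lookup 0 s terms i)

-- `k ≤ n` provides a subset of size `k`; with no such subset the letters `N` and `A` would both
-- hold vacuously.
allZero⇒N : ∀ {n} {B : SquareMatrix ℤ₂ n} {k x} → k ≤ n → AllZero ℤ₂ B k → IsTerm ℤ₂ B k x → x ≡ N
allZero⇒N {x = A} k≤n all≡0 all≢0 =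
  let α , ∣α∣≡k = subset-of-size k≤n in contradiction (all≡0 α ∣α∣≡k) (all≢0 α ∣α∣≡k)
allZero⇒N {x = S} k≤n all≡0 ((α , ∣α∣≡k , minor≢0) , _) = contradiction (all≡0 α ∣α∣≡k) minor≢0
allZero⇒N {x = N} k≤n all≡0 _ = refl

allNonzero⇒A : ∀ {n} {B : SquareMatrix ℤ₂ n} {k x} → k ≤ n → AllNonzero ℤ₂ B k → IsTerm ℤ₂ B k x → x ≡ A
allNonzero⇒A {x = A} k≤n all≢0 _ = refl
allNonzero⇒A {x = S} k≤n all≢0 (_ , ¬all≢0) = contradiction all≢0 ¬all≢0
allNonzero⇒A {x = N} k≤n all≢0 all≡0 =
  let α , ∣α∣≡k = subset-of-size k≤n in contradiction (all≡0 α ∣α∣≡k) (all≢0 α ∣α∣≡k)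

-- There is a single subset of full size, which is why `S` can never be the last letter.
someNonzero⇒allNonzero : ∀ {n k} {B : SquareMatrix ℤ₂ n} → k ≡ n → SomeNonzero ℤ₂ B k → AllNonzero ℤ₂ B k
someNonzero⇒allNonzero {B = B} refl (α , ∣α∣≡n , minor≢0) β ∣β∣≡n minor≡0 =
  minor≢0 (subst (λ γ → principalMinor ℤ₂ B γ ≡ 0ℙ) (trans (∣p∣≡n⇒p≡⊤ {p = β} ∣β∣≡n) (sym (∣p∣≡n⇒p≡⊤ {p = α} ∣α∣≡n))) minor≡0)

-- Necessity of the five forms.

NS-Tail : List Letter → Set
NS-Tail t =
    (∃[ a ] ∃[ b ] t ≡ NS ^ a ++ [ N ] ++ [ N ] ^ b)
  ⊎ (∃[ a ] t ≡ NS ^ a ++ NA)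
  ⊎ (∃[ a ] t ≡ NS ^ a ++ NA ++ [ N ])

NS-∷ : ∀ {t} → NS-Tail t → NS-Tail (NS ++ t)
NS-∷ (inj₁ (a , b , eq))      = inj₁ (suc a , b , cong (NS ++_) eq)
NS-∷ (inj₂ (inj₁ (a , eq)))   = inj₂ (inj₁ (suc a , cong (NS ++_) eq))
NS-∷ (inj₂ (inj₂ (a , eq)))   = inj₂ (inj₂ (suc a , cong (NS ++_) eq))

NA-Tail : List Letter → Set
NA-Tail t = (∃[ a ] t ≡ NA ^ a) ⊎ (∃[ a ] t ≡ NA ^ a ++ [ N ])

NA-∷ : ∀ {t} → NA-Tail t → NA-Tail (NA ++ t)
NA-∷ (inj₁ (a , eq)) = inj₁ (suc a , cong (NA ++_) eq)
NA-∷ (inj₂ (a , eq)) = inj₂ (suc a , cong (NA ++_) eq)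

shift₂ : ∀ m k → m ℕ.+ suc (suc k) ≡ suc (suc (m ℕ.+ k))
shift₂ m k = trans (+-suc m (suc k)) (cong suc (+-suc m k))

module _ {n} {B : SquareMatrix ℤ₂ n} (sym-B : Symmetric ℤ₂ B) (diag-B : ZeroDiagonal B) where

  odd-N : ∀ k m {x} → suc m ℕ.+ double k ≡ n → IsTerm ℤ₂ B (suc (double k)) x → x ≡ N
  odd-N k m refl = allZero⇒N (s≤s (m≤n+m (double k) m)) (odd-allZero sym-B diag-B k)

  -- Two consecutive orders suffice, as vanishing passes from each order to the one two above it.
  tail-N : ∀ k t → length t ℕ.+ k ≡ n → AllZero ℤ₂ B (suc k) → AllZero ℤ₂ B (suc (suc k)) →
    Terms B k t → t ≡ [ N ] ^ length t
  tail-N k []      eq z₁ z₂ terms = refl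
  tail-N k (x ∷ t) refl z₁ z₂ (term , terms) = cong₂ _∷_
    (allZero⇒N (s≤s (m≤n+m k (length t))) z₁ term)
    (tail-N (suc k) t (+-suc (length t) k) z₂ (allZero-ascend sym-B diag-B (suc k) z₁) terms)

  tail-A : Complete B → ∀ k t → length t ℕ.+ double k ≡ n → Terms B (double k) t → NA-Tail t
  tail-A complete k [] eq terms = inj₁ (0 , refl)
  tail-A complete k (x ∷ []) eq (term , _) with odd-N k 0 eq term
  ... | refl = inj₂ (0 , refl)
  tail-A complete k (x ∷ y ∷ t) eq (term₁ , term₂ , terms)
    with odd-N k (suc (length t)) eq term₁
       | allNonzero⇒A (≤-trans (s≤s (s≤s (m≤n+m (double k) (length t)))) (≤-reflexive eq))
           (complete⇒allNonzero sym-B diag-B complete (suc k)) term₂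
  ... | refl | refl = NA-∷ (tail-A complete (suc k) t (trans (shift₂ (length t) (double k)) eq) terms)

  -- Letters are read in pairs, after at least one `NS` block. The remaining list is nonempty
  -- because `S` cannot end the sequence.
  tail-S : ¬ Complete B → ∀ k x t → length (x ∷ t) ℕ.+ double (suc k) ≡ n →
    Terms B (double (suc k)) (x ∷ t) → NS-Tail (x ∷ t)
  tail-S ¬complete k x t eq (term , terms) with odd-N (suc k) (length t) eq term
  tail-S ¬complete k x [] eq terms | refl = inj₁ (0 , 0 , refl)
  tail-S ¬complete k x (N ∷ t) eq (_ , all≡0 , terms) | refl =
    inj₁ (0 , suc (length t) , cong (λ u → N ∷ N ∷ u)
      (tail-N (double (suc (suc k))) t (trans (shift₂ (length t) _) eq)
        (odd-allZero sym-B diag-B (suc (suc k))) (allZero-ascend sym-B diag-B _ all≡0) terms))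
  tail-S ¬complete k x (S ∷ []) refl (_ , (some≢0 , ¬all≢0) , _) | refl =
    contradiction (someNonzero⇒allNonzero {B = B} refl some≢0) ¬all≢0
  tail-S ¬complete k x (S ∷ y ∷ t) eq (_ , _ , terms) | refl =
    NS-∷ (tail-S ¬complete (suc k) y t (trans (shift₂ (suc (length t)) _) eq) terms)
  tail-S ¬complete k x (A ∷ []) eq terms | refl = inj₂ (inj₁ (0 , refl))
  tail-S ¬complete k x (A ∷ y ∷ []) eq (_ , _ , term , _) | refl
    with odd-N (suc (suc k)) 0 eq term
  ... | refl = inj₂ (inj₂ (0 , refl))
  -- Two letters after the `A` are exactly the room in which all minors being nonzero forces
  -- completeness.
  tail-S ¬complete k x (A ∷ y ∷ z ∷ t) eq (_ , all≢0 , _) | refl =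
    contradiction (allNonzero⇒complete sym-B diag-B (suc k) all≢0
      (≤-trans (s≤s (s≤s (s≤s (s≤s (m≤n+m _ (length t)))))) (≤-reflexive eq))) ¬complete

Forms : List Letter → Set
Forms s =
    (∃[ a ] s ≡ NA ++ NA ^ a)
  ⊎ (∃[ a ] s ≡ NA ++ NA ^ a ++ [ N ])
  ⊎ (∃[ a ] ∃[ b ] s ≡ NS ^ a ++ [ N ] ++ [ N ] ^ b)
  ⊎ (∃[ a ] s ≡ NS ++ NS ^ a ++ NA)
  ⊎ (∃[ a ] s ≡ NS ++ NS ^ a ++ NA ++ [ N ])

NA-forms : ∀ {t} → NA-Tail t → Forms (NA ++ t)
NA-forms (inj₁ (a , eq)) = inj₁ (a , cong (NA ++_) eq)
NA-forms (inj₂ (a , eq)) = inj₂ (inj₁ (a , cong (NA ++_) eq))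

NS-forms : ∀ {t} → NS-Tail t → Forms (NS ++ t)
NS-forms (inj₁ (a , b , eq))    = inj₂ (inj₂ (inj₁ (suc a , b , cong (NS ++_) eq)))
NS-forms (inj₂ (inj₁ (a , eq))) = inj₂ (inj₂ (inj₂ (inj₁ (a , cong (NS ++_) eq))))
NS-forms (inj₂ (inj₂ (a , eq))) = inj₂ (inj₂ (inj₂ (inj₂ (a , cong (NS ++_) eq))))

attainable⇒forms : ∀ s → head s ≡ just N → Attainable ℤ₂ s → Forms s
attainable⇒forms s@(N ∷ t) refl (_ , B , sym-B , epr) = go t refl (isEpr⇒terms s epr)
  where
  diag-B : ZeroDiagonal B
  diag-B = allZero₁⇒zeroDiagonal sym-B (epr zero)
  -- The order of `B` depends on `t`, so the cases are split on a copy `t′` linked to it by an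
  -- equation.
  go : ∀ t′ → t′ ≡ t → Terms B 0 (N ∷ t′) → Forms (N ∷ t′)
  go []      _    _ = inj₂ (inj₂ (inj₁ (0 , 0 , refl)))
  go (N ∷ t) refl (_ , all≡0 , terms) = inj₂ (inj₂ (inj₁ (0 , suc (length t) , cong (λ u → N ∷ N ∷ u)
    (tail-N sym-B diag-B 2 t (ℕ.+-comm (length t) 2) (odd-allZero sym-B diag-B 1) (allZero-ascend sym-B diag-B 2 all≡0) terms))))
  go (A ∷ []) _ _ = NA-forms (inj₁ (0 , refl))
  go (A ∷ x ∷ []) refl (_ , _ , term , _) with odd-N sym-B diag-B 1 0 refl term
  ... | refl = NA-forms (inj₂ (0 , refl))
  -- Two further letters make the order at least 4, so `A` at order 2 forces a complete graph.
  go (A ∷ t@(x ∷ y ∷ t′)) refl (_ , all≢0 , terms) =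
    NA-forms (tail-A sym-B diag-B (allNonzero⇒complete sym-B diag-B 0 all≢0 (s≤s (s≤s (s≤s (s≤s z≤n)))))
      1 t (ℕ.+-comm (length t) 2) terms)
  go (S ∷ []) refl (_ , (some≢0 , ¬all≢0) , _) = contradiction (someNonzero⇒allNonzero {B = B} refl some≢0) ¬all≢0
  -- A complete graph would have all minors of order 2 nonzero, which `S` excludes.
  go (S ∷ x ∷ t) refl (_ , (_ , ¬all≢0) , terms) =
    NS-forms (tail-S sym-B diag-B (λ complete → ¬all≢0 (complete⇒allNonzero sym-B diag-B complete 1)) 0 x t
      (ℕ.+-comm (suc (length t)) 2) terms)

-- Sufficiency: assembling sequences from their even positions.

double-mono : ∀ {j k} → j ≤ k → double j ≤ double k
double-mono z≤n       = z≤n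
double-mono (s≤s j≤k) = s≤s (s≤s (double-mono j≤k))

someNonzero-below : ∀ {n} {B : SquareMatrix ℤ₂ n} → Symmetric ℤ₂ B → ZeroDiagonal B →
  ∀ {j k} → j ≤′ k → SomeNonzero ℤ₂ B (double k) → SomeNonzero ℤ₂ B (double j)
someNonzero-below sym-B diag-B (≤′-reflexive refl) some≢0 = some≢0
someNonzero-below sym-B diag-B (≤′-step j≤k)       some≢0 =
  someNonzero-below sym-B diag-B j≤k (someNonzero-descend sym-B diag-B _ some≢0)

module _ {n} {B : SquareMatrix ℤ₂ n} (sym-B : Symmetric ℤ₂ B) (diag-B : ZeroDiagonal B) where

  -- Odd positions hold `N` for every alternating matrix, so only the even ones have to be supplied.
  -- Of the `m` blocks, `k` are already passed and `a` remain.
  terms-repeat : ∀ {x t} m → (∀ j → j < m → IsTerm ℤ₂ B (double (suc j)) x) →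
    Terms B (double m) t → ∀ a k → a ℕ.+ k ≡ m → Terms B (double k) ((N ∷ x ∷ []) ^ a ++ t)
  terms-repeat m evens terms zero    k refl = terms
  terms-repeat m evens terms (suc a) k refl =
    odd-allZero sym-B diag-B k , evens k (s≤s (m≤n+m k a)) ,
    terms-repeat m evens terms a (suc k) (+-suc a k)

  terms-N : ∀ k b → (∀ m → k < m → AllZero ℤ₂ B m) → Terms B k ([ N ] ^ b)
  terms-N k zero    all≡0 = tt
  terms-N k (suc b) all≡0 = all≡0 (suc k) ≤-refl , terms-N (suc k) b λ m k<m → all≡0 m (≤-trans (m≤n⇒m≤1+n ≤-refl) k<m)

  -- One nonzero minor of order 2m + 2 descends to all smaller even orders. An `A` at one of these
  -- would leave room for two more indices and force completeness.
  evens-S : ∀ m → SomeNonzero ℤ₂ B (double (suc m)) → double (suc m) ≤ n → ¬ Complete B →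
    ∀ j → j < m → IsTerm ℤ₂ B (double (suc j)) S
  evens-S m some≢0 2m+2≤n ¬complete j j<m =
    someNonzero-below sym-B diag-B (≤⇒≤′ (≤-trans j<m (m≤n⇒m≤1+n ≤-refl))) some≢0 ,
    λ all≢0 → ¬complete (allNonzero⇒complete sym-B diag-B j all≢0 (≤-trans (double-mono (s≤s j<m)) 2m+2≤n))

length-repeat : ∀ x a t → length ((N ∷ x ∷ []) ^ a ++ t) ≡ double a ℕ.+ length t
length-repeat x zero    t = refl
length-repeat x (suc a) t = cong (λ l → suc (suc l)) (length-repeat x a t)

length-N : ∀ b → length ([ N ] ^ b) ≡ b
length-N zero    = refl
length-N (suc b) = cong suc (length-N b)

-- Complete graphs

unit-sym : ∀ {n} (i j : Fin n) → unit i j ≡ unit j i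
unit-sym zero    zero    = refl
unit-sym zero    (suc j) = refl
unit-sym (suc i) zero    = refl
unit-sym (suc i) (suc j) = unit-sym i j

complete : ∀ n → SquareMatrix ℤ₂ n
complete n i j = 1ℙ + unit i j

complete-sym : ∀ n → Symmetric ℤ₂ (complete n)
complete-sym n i j = cong (1ℙ +_) (unit-sym i j)

complete-diag : ∀ n → ZeroDiagonal (complete n)
complete-diag n i = cong (1ℙ +_) (unit-diag i)

complete-A : ∀ n k → AllNonzero ℤ₂ (complete n) (double k)
complete-A n = complete⇒allNonzero (complete-sym n) (complete-diag n) λ i j i≢j →
  cong (1ℙ +_) (unit-off {i = i} (i≢j ∘ sym))

attainable-NA : ∀ a t → (∀ {n} → Terms (complete n) (double (suc a)) t) → Attainable ℤ₂ (NA ^ suc a ++ t)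
attainable-NA a t terms = attainable (λ ()) (length-repeat A (suc a) t) (complete _) (complete-sym _)
  (terms-repeat (complete-sym _) (complete-diag _) (suc a) (λ j _ → complete-A _ (suc j)) terms (suc a) 0 (ℕ.+-identityʳ (suc a)))

-- Disjoint unions of a edges and c isolated vertices

matching : ∀ a {c} → SquareMatrix ℤ₂ (double a ℕ.+ c)
matching zero    i             j             = 0ℙ
matching (suc a) zero          (suc zero)    = 1ℙ
matching (suc a) (suc zero)    zero          = 1ℙ
matching (suc a) (suc (suc i)) (suc (suc j)) = matching a i j
matching (suc a) _             _             = 0ℙ

matching-sym : ∀ a {c} → Symmetric ℤ₂ (matching a {c})
matching-sym zero    i             j             = refl
matching-sym (suc a) zero          zero          = refl
matching-sym (suc a) zero          (suc zero)    = refl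
matching-sym (suc a) zero          (suc (suc j)) = refl
matching-sym (suc a) (suc zero)    zero          = refl
matching-sym (suc a) (suc zero)    (suc zero)    = refl
matching-sym (suc a) (suc zero)    (suc (suc j)) = refl
matching-sym (suc a) (suc (suc i)) zero          = refl
matching-sym (suc a) (suc (suc i)) (suc zero)    = refl
matching-sym (suc a) (suc (suc i)) (suc (suc j)) = matching-sym a i j

matching-diag : ∀ a {c} → ZeroDiagonal (matching a {c})
matching-diag zero    i             = refl
matching-diag (suc a) zero          = refl
matching-diag (suc a) (suc zero)    = refl
matching-diag (suc a) (suc (suc i)) = matching-diag a i

matched : ∀ a c → Subset (double a ℕ.+ c)
matched zero    c = ⊥
matched (suc a) c = inside ∷ inside ∷ matched a c

∣matched∣ : ∀ a c → ∣ matched a c ∣ ≡ double a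
∣matched∣ zero    c = ∣⊥∣≡0 c
∣matched∣ (suc a) c = cong (λ l → suc (suc l)) (∣matched∣ a c)

∈matched : ∀ a i → i ∈ matched a 0
∈matched (suc a) zero          = here
∈matched (suc a) (suc zero)    = there here
∈matched (suc a) (suc (suc i)) = there (there (∈matched a i))

isolated : ∀ a {c} → ∃[ i ] i ∉ matched a (suc c)
isolated zero    = zero , ∉⊥
isolated (suc a) = let i , i∉ = isolated a in suc (suc i) , λ { (there (there i∈)) → i∉ i∈ }

matching-isolated : ∀ a {c} {i} → i ∉ matched a c → ∀ j → matching a j i ≡ 0ℙ
matching-isolated zero    i∉ j = refl
matching-isolated (suc a) {i = zero}        i∉ j             = contradiction here i∉
matching-isolated (suc a) {i = suc zero}    i∉ j             = contradiction (there here) i∉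
matching-isolated (suc a) {i = suc (suc i)} i∉ zero          = refl
matching-isolated (suc a) {i = suc (suc i)} i∉ (suc zero)    = refl
matching-isolated (suc a) {i = suc (suc i)} i∉ (suc (suc j)) = matching-isolated a (i∉ ∘ there ∘ there) j

matching-row₀ : ∀ a {c} (v : Vector Parity (double (suc a) ℕ.+ c)) → matching (suc a) zero · v ≡ v (suc zero)
matching-row₀ a v = sum-single (λ j → matching (suc a) zero j * v j) (suc zero)
  λ { zero _ → refl ; (suc zero) j≢1 → contradiction refl j≢1 ; (suc (suc j)) _ → refl }

matching-row₁ : ∀ a {c} (v : Vector Parity (double (suc a) ℕ.+ c)) → matching (suc a) (suc zero) · v ≡ v zero
matching-row₁ a v = sum-single (λ j → matching (suc a) (suc zero) j * v j) zero
  λ { zero j≢0 → contradiction refl j≢0 ; (suc zero) _ → refl ; (suc (suc j)) _ → refl }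

-- Each row of an edge reads off the entry at its other end, and `v` is zero at the isolated
-- vertices.
matching-kernel : ∀ a {c} v → VanishesOff (matched a c) v →
  (∀ i → i ∈ matched a c → matching a i · v ≡ 0ℙ) → ∀ i → v i ≡ 0ℙ
matching-kernel zero    v v≡0 Mv≡0 i             = v≡0 i ∉⊥
matching-kernel (suc a) v v≡0 Mv≡0 zero          = trans (sym (matching-row₁ a v)) (Mv≡0 (suc zero) (there here))
matching-kernel (suc a) v v≡0 Mv≡0 (suc zero)    = trans (sym (matching-row₀ a v)) (Mv≡0 zero here)
matching-kernel (suc a) v v≡0 Mv≡0 (suc (suc i)) = matching-kernel a (λ j → v (suc (suc j)))
  (λ j j∉ → v≡0 (suc (suc j)) λ { (there (there j∈)) → j∉ j∈ })
  (λ j j∈ → Mv≡0 (suc (suc j)) (there (there j∈))) i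

-- Every vertex of a perfect matching has degree 1, so joining an apex makes all degrees even.
matching-ones : ∀ a i → matching a {0} i · (λ _ → 1ℙ) ≡ 1ℙ
matching-ones (suc a) zero          = matching-row₀ a (λ _ → 1ℙ)
matching-ones (suc a) (suc zero)    = matching-row₁ a (λ _ → 1ℙ)
matching-ones (suc a) (suc (suc i)) = matching-ones a i

matching-someNonzero : ∀ a {c} → SomeNonzero ℤ₂ (matching a {c}) (double a)
matching-someNonzero a {c} = matched a c , ∣matched∣ a c , λ minor≡0 →
  let v , v≡0 , (i , vᵢ≡1) , Mv≡0 = minor≡0⇒singular (matching-sym a) (matched a c) minor≡0 in
  1≢0 (trans (sym vᵢ≡1) (matching-kernel a v v≡0 Mv≡0 i))

matching-¬complete : ∀ a {c} → ¬ Complete (matching (suc (suc a)) {c})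
-- Vertices 0 and 2 lie on different edges.
matching-¬complete a complete = 1≢0 (sym (complete zero (suc (suc zero)) λ ()))

-- A subset with more than 2a elements contains an isolated vertex, whose row is zero.
matching-allZero : ∀ a {c} k → double a < k → AllZero ℤ₂ (matching a {c}) k
matching-allZero a {c} k 2a<k α ∣α∣≡k with principalMinor ℤ₂ (matching a) α ℙ.≟ 0ℙ
... | yes minor≡0 = minor≡0
... | no  minor≢0 = contradiction
  (subst (_≤ double a) ∣α∣≡k (subst (∣ α ∣ ≤_) (∣matched∣ a c) (p⊆q⇒∣p∣≤∣q∣ α⊆matched)))
  (<⇒≱ 2a<k)
  where
  α⊆matched : α ⊆ matched a c
  α⊆matched {i} i∈α with i ∈? matched a c
  ... | yes i∈ = i∈
  ... | no  i∉ = contradiction (minor≡0-zeroRow (matching-sym a) α i∈α (matching-isolated a i∉)) minor≢0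

-- A nonzero minor is obtained by descent from the matched vertices, a zero one by putting an
-- isolated vertex into the subset.
matching-S : ∀ a {c} j → j < a → IsTerm ℤ₂ (matching a {suc c}) (double (suc j)) S
matching-S a {c} j j<a =
  someNonzero-below (matching-sym a) (matching-diag a) (≤⇒≤′ j<a) (matching-someNonzero a) , λ all≢0 →
  let i , i∉ = isolated a
      α , i∈α , ∣α∣≡ = superset ⁅ i ⁆ (double (suc j)) (≤-trans (≤-reflexive (∣⁅x⁆∣≡1 i)) (s≤s z≤n))
                                (≤-trans (double-mono j<a) (ℕ.m≤m+n (double a) (suc c)))
  in all≢0 α ∣α∣≡ (minor≡0-zeroRow (matching-sym a) α (i∈α (x∈⁅x⁆ i)) (matching-isolated a i∉))

attainable-NS-N : ∀ a b → Attainable ℤ₂ (NS ^ a ++ [ N ] ++ [ N ] ^ b)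
attainable-NS-N a b = attainable (nonempty a)
  (trans (length-repeat S a ([ N ] ^ suc b)) (cong (λ l → double a ℕ.+ suc l) (length-N b)))
  -- There are b + 1 isolated vertices, one for each `N` of the final run.
  (matching a) (matching-sym a)
  (terms-repeat (matching-sym a) (matching-diag a) a (matching-S a)
    (terms-N (matching-sym a) (matching-diag a) (double a) (suc b) (matching-allZero a)) a 0 (ℕ.+-identityʳ a))
  where
  nonempty : ∀ a {t} → NS ^ a ++ [ N ] ++ t ≢ []
  nonempty zero    ()
  nonempty (suc a) ()

-- A perfect matching with a + 2 edges is nonsingular, whence the final `A`; having at least two
-- edges it is not complete, whence `S` before.
attainable-NS-NA : ∀ a → Attainable ℤ₂ (NS ++ NS ^ a ++ NA)
attainable-NS-NA a = attainable (λ ())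
  (trans (length-repeat S (suc a) NA) (trans (ℕ.+-comm (double (suc a)) 2) order))
  B (matching-sym (suc (suc a)))
  (terms-repeat (matching-sym (suc (suc a))) (matching-diag (suc (suc a))) (suc a)
    (evens-S (matching-sym (suc (suc a))) (matching-diag (suc (suc a))) (suc a) some≢0
      (≤-reflexive order) (matching-¬complete a))
    (odd-allZero (matching-sym (suc (suc a))) (matching-diag (suc (suc a))) (suc a) ,
      someNonzero⇒allNonzero {B = B} order some≢0 , tt)
    (suc a) 0 (ℕ.+-identityʳ (suc a)))
  where
  B = matching (suc (suc a)) {0}
  some≢0 = matching-someNonzero (suc (suc a)) {0}
  order : double (suc (suc a)) ≡ double (suc (suc a)) ℕ.+ 0
  order = sym (ℕ.+-identityʳ (double (suc (suc a))))

-- Friendship graphs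

-- Joins a new vertex 0 to all others; over a perfect matching this gives triangles sharing that
-- vertex.
apex : ∀ {n} → SquareMatrix ℤ₂ n → SquareMatrix ℤ₂ (suc n)
apex M zero    zero    = 0ℙ
apex M zero    (suc j) = 1ℙ
apex M (suc i) zero    = 1ℙ
apex M (suc i) (suc j) = M i j

apex-sym : ∀ {n} {M : SquareMatrix ℤ₂ n} → Symmetric ℤ₂ M → Symmetric ℤ₂ (apex M)
apex-sym sym-M zero    zero    = refl
apex-sym sym-M zero    (suc j) = refl
apex-sym sym-M (suc i) zero    = refl
apex-sym sym-M (suc i) (suc j) = sym-M i j

apex-diag : ∀ {n} {M : SquareMatrix ℤ₂ n} → ZeroDiagonal M → ZeroDiagonal (apex M)
apex-diag diag-M zero    = refl
apex-diag diag-M (suc i) = diag-M i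

one-missing : ∀ {n} (α : Subset (suc n)) → ∣ α ∣ ≡ n → ∃[ p ] (p ∉ α × ∀ i → i ≢ p → i ∈ α)
one-missing (outside ∷ α) ∣α∣≡n with ∣p∣≡n⇒p≡⊤ {p = α} ∣α∣≡n
... | refl = zero , (λ ()) , λ { zero 0≢0 → contradiction refl 0≢0 ; (suc i) _ → there ∈⊤ }
one-missing {suc n} (inside ∷ α) ∣α∣≡n =
  let p , p∉α , rest = one-missing α (suc-injective ∣α∣≡n) in
  suc p , (λ { (there p∈α) → p∉α p∈α }) , λ { zero _ → here ; (suc i) i≢p → there (rest i (i≢p ∘ cong suc)) }

-- The kernel of the apex matrix is spanned by the all-ones vector. A vector that
-- it maps to zero except at one index p is in the kernel, since its columns sum to zero.
apex-allNonzero : ∀ {n} {M : SquareMatrix ℤ₂ n} → Symmetric ℤ₂ M → ∀ k → n ≡ double k →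
  (∀ v → (∀ i → M i · v ≡ 0ℙ) → ∀ i → v i ≡ 0ℙ) → (∀ i → M i · (λ _ → 1ℙ) ≡ 1ℙ) →
  AllNonzero ℤ₂ (apex M) n
apex-allNonzero {n} {M} sym-M k n≡2k M-injective M-ones α ∣α∣≡n minor≡0
  with minor≡0⇒singular (apex-sym sym-M) α minor≡0 | one-missing α ∣α∣≡n
... | v , v≡0 , (i , vᵢ≡1) , Bv≡0 | p , p∉α , ∈α =
  1≢0 (trans (sym vᵢ≡1) (trans (constant i) (trans (sym (constant p)) (v≡0 p p∉α))))
  where
  B = apex M
  ones : ∀ {m} → Vector Parity m
  ones _ = 1ℙ
  -- All degrees are even: the apex has n = 2k neighbours, and any other vertex gains the apex as a
  -- second one modulo 2.
  B-ones : ∀ i → B i · ones ≡ 0ℙ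
  B-ones zero    = sum-even-constant k n≡2k 1ℙ (ones {n}) λ _ → refl
  B-ones (suc i) = cong (1ℙ +_) (M-ones i)
  Bvₚ≡0 : B p · v ≡ 0ℙ
  Bvₚ≡0 = begin
    B p · v                    ≡⟨ sum-single (λ j → B j · v) p (λ j j≢p → Bv≡0 j (∈α j j≢p)) ⟨
    ones · (λ j → B j · v)     ≡⟨ adjoint (apex-sym sym-M) ones v ⟩
    v · (λ j → B j · ones)     ≡⟨ ·-zeroʳ v B-ones ⟩
    0ℙ                         ∎
  kernel : ∀ j → B j · v ≡ 0ℙ
  kernel j with j Fin.≟ p
  ... | yes refl = Bvₚ≡0
  ... | no  j≢p  = Bv≡0 j (∈α j j≢p)
  -- Since `M` fixes the all-ones vector, the contribution of the apex can be moved into the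
  -- argument of `M`; injectivity then makes all entries of `v` equal to `v zero`.
  shifted : ∀ j → M j · ((v ∘ suc) +[ v zero ] ones) ≡ 0ℙ
  shifted j = begin
    M j · ((v ∘ suc) +[ v zero ] ones)          ≡⟨ ·-linearʳ (v ∘ suc) (v zero) ones (M j) ⟩
    M j · (v ∘ suc) + v zero * (M j · ones)     ≡⟨ cong (λ x → M j · (v ∘ suc) + v zero * x) (M-ones j) ⟩
    M j · (v ∘ suc) + v zero * 1ℙ               ≡⟨ cong (M j · (v ∘ suc) +_) (ℙ.*-identityʳ (v zero)) ⟩
    M j · (v ∘ suc) + v zero                    ≡⟨ ℙ.+-comm (M j · (v ∘ suc)) (v zero) ⟩
    B (suc j) · v                               ≡⟨ kernel (suc j) ⟩
    0ℙ                                          ∎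
  constant : ∀ j → v j ≡ v zero
  constant zero    = refl
  constant (suc j) = p+q≡0⇒p≡q (v (suc j)) (v zero)
    (trans (cong (v (suc j) +_) (sym (ℙ.*-identityʳ (v zero)))) (M-injective _ shifted j))

-- The friendship graph with a + 2 triangles has order 2a + 5, so its `A` stands at the last even
-- position, one before the end, and completeness is not forced.
attainable-NS-NAN : ∀ a → Attainable ℤ₂ (NS ++ NS ^ a ++ NA ++ [ N ])
attainable-NS-NAN a = attainable (λ ())
  (trans (length-repeat S (suc a) (NA ++ [ N ])) (trans (ℕ.+-comm (double (suc a)) 3) (cong suc order)))
  B sym-B
  (terms-repeat sym-B diag-B (suc a) (evens-S sym-B diag-B (suc a) some≢0 2a+4≤n ¬complete)
    (odd-allZero sym-B diag-B (suc a) , all≢0 , odd-allZero sym-B diag-B (suc (suc a)) , tt)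
    (suc a) 0 (ℕ.+-identityʳ (suc a)))
  where
  m = suc (suc a)
  M = matching m {0}
  B = apex M
  sym-B = apex-sym (matching-sym m {0})
  diag-B = apex-diag (matching-diag m {0})
  order : double m ≡ double m ℕ.+ 0
  order = sym (ℕ.+-identityʳ (double m))
  2a+4≤n : double m ≤ suc (double m ℕ.+ 0)
  2a+4≤n = m≤n⇒m≤1+n (≤-reflexive order)
  all≢0 : AllNonzero ℤ₂ B (double m)
  all≢0 = subst (AllNonzero ℤ₂ B) (sym order) (apex-allNonzero (matching-sym m) m (sym order)
    (λ v Mv≡0 → matching-kernel m v (λ i i∉ → contradiction (∈matched m i) i∉) (λ i _ → Mv≡0 i))
    (matching-ones m))
  some≢0 : SomeNonzero ℤ₂ B (double m)
  some≢0 = let α , ∣α∣≡ = subset-of-size 2a+4≤n in α , ∣α∣≡ , all≢0 α ∣α∣≡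
  -- ¬ requires one missing edge: vertices 1 and 3 lie in different triangles.
  ¬complete : ¬ Complete B
  ¬complete complete = 1≢0 (sym (complete (suc zero) (suc (suc (suc zero))) λ ()))

forms⇒attainable : ∀ s → Forms s → Attainable ℤ₂ s
forms⇒attainable s (inj₁ (a , refl)) =
  subst (Attainable ℤ₂) (++-identityʳ (NA ^ suc a)) (attainable-NA a [] tt)
forms⇒attainable s (inj₂ (inj₁ (a , refl))) =
  attainable-NA a [ N ] (odd-allZero (complete-sym _) (complete-diag _) (suc a) , tt)
forms⇒attainable s (inj₂ (inj₂ (inj₁ (a , b , refl)))) = attainable-NS-N a b
forms⇒attainable s (inj₂ (inj₂ (inj₂ (inj₁ (a , refl))))) = attainable-NS-NA a
forms⇒attainable s (inj₂ (inj₂ (inj₂ (inj₂ (a , refl))))) = attainable-NS-NAN a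

theorem3p2 : (s : List Letter) → head s ≡ just N →
    Attainable ℤ₂ s ⇔
    ( (∃[ a ] s ≡ NA ++ NA ^ a)
    ⊎ (∃[ a ] s ≡ NA ++ NA ^ a ++ [ N ])
    ⊎ (∃[ a ] ∃[ b ] s ≡ NS ^ a ++ [ N ] ++ [ N ] ^ b)
    ⊎ (∃[ a ] s ≡ NS ++ NS ^ a ++ NA)
    ⊎ (∃[ a ] s ≡ NS ++ NS ^ a ++ NA ++ [ N ]) )
theorem3p2 s head≡N = mk⇔ (attainable⇒forms s head≡N) (forms⇒attainable s)
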